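{- Let $G$ be a weakly distance-regular graph with at least six vertices and parameters $(k,\lambda,\mu')$ with $\mu'\ge 2$. Then $G$ is $2$-reconstructible; that is, if $G$ has $n$ vertices, then every $n$-vertex graph having the same $(n-2)$-deck as $G$ is isomorphic to $G$.
   Context: All graphs are finite, simple (no loops or multiple edges). For an $n$-vertex graph $G$ and $1\le k\le n$, the $k$-deck of $G$ is the multiset of isomorphism classes of the $\binom{n}{k}$ induced subgraphs of $G$ on $k$ vertices (one for each $k$-subset of $V(G)$). A graph is $\ell$-reconstructible if it is determined up to isomorphism by its $(n-\ell)$-deck. A graph is weakly distance-regular with parameters $(k,\lambda,\mu')$ if it is $k$-regular, any two adjacent vertices have exactly $\lambda$ common neighbors, and any two vertices at distance exactly $2$ have exactly $\mu'$ common neighbors. -}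

module Defs where

open import Data.Nat using (ℕ; suc; _≤_; _∸_)
open import Data.Bool using (Bool; true; false; _∧_)
open import Data.Fin using (Fin)
open import Data.Fin.Subset using (Subset; _∈_; ∣_∣)
open import Data.Vec using (tabulate)
open import Data.Product using (Σ; _×_; ∃)
open import Relation.Binary.PropositionalEquality using (_≡_; _≢_)

record Graph (n : ℕ) : Set where
  field
    adj   : Fin n → Fin n → Bool
    sym   : ∀ u v → adj u v ≡ adj v u
    irrefl : ∀ v → adj v v ≡ false
open Graph public

Adj : ∀ {n} → Graph n → Fin n → Fin n → Set
Adj G u v = adj G u v ≡ true

nbrs : ∀ {n} → Graph n → Fin n → Subset n
nbrs G v = tabulate (λ w → adj G v w)

degree : ∀ {n} → Graph n → Fin n → ℕ
degree G v = ∣ nbrs G v ∣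

commonNbrs : ∀ {n} → Graph n → Fin n → Fin n → Subset n
commonNbrs G u v = tabulate (λ w → adj G u w ∧ adj G v w)

numCommon : ∀ {n} → Graph n → Fin n → Fin n → ℕ
numCommon G u v = ∣ commonNbrs G u v ∣

Dist2 : ∀ {n} → Graph n → Fin n → Fin n → Set
Dist2 G u v = u ≢ v × adj G u v ≡ false × ∃ (λ w → Adj G u w × Adj G w v)

WeaklyDistanceRegular : ∀ {n} → Graph n → ℕ → ℕ → ℕ → Set
WeaklyDistanceRegular G k l μ′ =
  (∀ v → degree G v ≡ k) ×
  (∀ u v → Adj G u v → numCommon G u v ≡ l) ×
  (∀ u v → Dist2 G u v → numCommon G u v ≡ μ′)

_≅_ : ∀ {n m} → Graph n → Graph m → Set
_≅_ {n} {m} G H =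
  Σ (Fin n → Fin m) λ f → Σ (Fin m → Fin n) λ g →
    (∀ x → g (f x) ≡ x) × (∀ y → f (g y) ≡ y) ×
    (∀ u v → adj G u v ≡ adj H (f u) (f v))

-- Isomorphism of induced subgraphs G[S] ≅ H[T]: mutually inverse maps
-- between S and T (given as maps on the whole vertex sets, only their
-- restrictions matter) preserving adjacency within S.
InducedIso : ∀ {n m} → Graph n → Subset n → Graph m → Subset m → Set
InducedIso {n} {m} G S H T =
  Σ (Fin n → Fin m) λ f → Σ (Fin m → Fin n) λ g →
    (∀ x → x ∈ S → f x ∈ T) × (∀ y → y ∈ T → g y ∈ S) ×
    (∀ x → x ∈ S → g (f x) ≡ x) × (∀ y → y ∈ T → f (g y) ≡ y) ×
    (∀ u v → u ∈ S → v ∈ S → adj G u v ≡ adj H (f u) (f v))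

-- G and H (on the same number n of vertices) have the same k-deck:
-- there is a bijection between the k-subsets of V(G) and the k-subsets
-- of V(H) matching each induced subgraph with an isomorphic one
-- (i.e. equality of the multisets of isomorphism classes).
SameDeck : ∀ {n} → ℕ → Graph n → Graph n → Set
SameDeck {n} k G H =
  Σ (Subset n → Subset n) λ φ → Σ (Subset n → Subset n) λ ψ →
    (∀ S → ∣ S ∣ ≡ k → ∣ φ S ∣ ≡ k) ×
    (∀ T → ∣ T ∣ ≡ k → ∣ ψ T ∣ ≡ k) ×
    (∀ S → ∣ S ∣ ≡ k → ψ (φ S) ≡ S) ×
    (∀ T → ∣ T ∣ ≡ k → φ (ψ T) ≡ T) ×
    (∀ S → ∣ S ∣ ≡ k → InducedIso G S H (φ S))

Reconstructible : ∀ {n} → ℕ → Graph n → Set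
Reconstructible {n} ℓ G = ∀ (H : Graph n) → SameDeck (n ∸ ℓ) G H → G ≅ H

{-# OPTIONS --safe #-}
module Submission where

-- Counting labelled copies of patterns with at most n − 2 vertices (Kelly's lemma) shows that any H
-- with the deck of G is again weakly distance-regular with the same parameters: the first moments of
-- the degrees, and of the numbers of common neighbours, over suitable index sets determine
-- ∑ (degree − k)² and its analogues. For the pairs at distance 2 this takes five vertices, so n = 6
-- is separate: there μ′ = k is the maximal conceivable value, and one moment less suffices.
--
-- Now let the card G − {u, v} be isomorphic to H − {x, y}. Degrees in the card tell how many removed
-- vertices each w was adjacent to. If w and z each lost one, they lost the same one exactly when their
-- number of common neighbours dropped by one: from λ if they are adjacent, and otherwise from μ′ to
-- μ′ − 1, which is neither 0 nor μ′ because μ′ ≥ 2. So the card isomorphism matches the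
-- neighbourhoods of u and v with those of x and y, up to exchanging x and y, and extends.

open import Defs
open import Data.Bool using (Bool; true; false; T; not; _∧_)
import Data.Bool.Properties as Bool
open import Data.Empty using (⊥-elim)
open import Data.Fin using (Fin; zero; suc; toℕ; fromℕ<)
import Data.Fin.Properties as Fin
open import Data.Fin.Subset using (Subset; inside; ∣_∣; ⊥; ⊤)
open import Data.Fin.Subset.Properties using (∣⊥∣≡0; ∣⊤∣≡n; ∣p∣≤n; ∣p∣≡n⇒p≡⊤)
open import Data.List using (List; []; _∷_; _++_; allFin; cartesianProductWith; map)
open import Data.List.Properties using (map-tabulate)
open import Data.Nat using (ℕ; zero; suc; _+_; _*_; _∸_; _≤_; _≤?_; _≡ᵇ_; ∣_-_∣; z≤n; s≤s; ≢-nonZero)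
open import Data.Nat.Properties hiding (_≟_; _≤?_)
import Data.Nat.Properties as ℕ
open import Data.Nat.Tactic.RingSolver using (solve-∀)
open import Data.Product using (_×_; _,_; proj₁; proj₂; ∃; ∃₂)
open import Data.Sum using (inj₁; inj₂)
open import Data.Unit using (tt)
open import Data.Vec as Vec using (Vec; []; _∷_; head; tail; lookup; _[_]≔_)
import Data.Vec.Properties as Vec
open import Function using (_∘_; id)
open import Relation.Binary.Definitions using (DecidableEquality)
open import Relation.Binary.PropositionalEquality hiding (sym)
import Relation.Binary.PropositionalEquality as ≡
open import Relation.Nullary using (Dec; does; yes; no; ¬_; ¬?; _×-dec_)

-- Finite sums over lists.

⟦_⟧ : Bool → ℕ
⟦ true ⟧ = 1
⟦ false ⟧ = 0

⟦∧⟧ : ∀ a b → ⟦ a ∧ b ⟧ ≡ ⟦ a ⟧ * ⟦ b ⟧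
⟦∧⟧ true true = refl
⟦∧⟧ true false = refl
⟦∧⟧ false b = refl

private variable
  A B : Set

∑ : List A → (A → ℕ) → ℕ
∑ [] f = 0
∑ (x ∷ xs) f = f x + ∑ xs f

infix 5 ∑
syntax ∑ xs (λ x → e) = ∑[ x ∈ xs ] e

∑-cong : ∀ (xs : List A) {f g : A → ℕ} → (∀ x → f x ≡ g x) → ∑ xs f ≡ ∑ xs g
∑-cong [] e = refl
∑-cong (x ∷ xs) e = cong₂ _+_ (e x) (∑-cong xs e)

∑-mono-≤ : ∀ (xs : List A) {f g : A → ℕ} → (∀ x → f x ≤ g x) → ∑ xs f ≤ ∑ xs g
∑-mono-≤ [] e = z≤n
∑-mono-≤ (x ∷ xs) e = +-mono-≤ (e x) (∑-mono-≤ xs e)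

∑-zero : ∀ (xs : List A) → ∑ xs (λ _ → 0) ≡ 0
∑-zero [] = refl
∑-zero (x ∷ xs) = ∑-zero xs

∑-+ : ∀ (xs : List A) (f g : A → ℕ) → ∑ xs (λ x → f x + g x) ≡ ∑ xs f + ∑ xs g
∑-+ [] f g = refl
∑-+ (x ∷ xs) f g =
  trans (cong (f x + g x +_) (∑-+ xs f g)) (interchange (f x) (g x) (∑ xs f) (∑ xs g))
  where
  interchange : ∀ a b c d → a + b + (c + d) ≡ a + c + (b + d)
  interchange = solve-∀

*-∑ : ∀ c (xs : List A) (f : A → ℕ) → c * ∑ xs f ≡ ∑ xs (λ x → c * f x)
*-∑ c [] f = *-zeroʳ c
*-∑ c (x ∷ xs) f = trans (*-distribˡ-+ c (f x) (∑ xs f)) (cong (c * f x +_) (*-∑ c xs f))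

∑-* : ∀ (xs : List A) (f : A → ℕ) c → ∑ xs f * c ≡ ∑ xs (λ x → f x * c)
∑-* xs f c = trans (*-comm (∑ xs f) c) (trans (*-∑ c xs f) (∑-cong xs (λ x → *-comm c (f x))))

∑-swap : ∀ (xs : List A) (ys : List B) (f : A → B → ℕ) →
  ∑[ x ∈ xs ] ∑[ y ∈ ys ] f x y ≡ ∑[ y ∈ ys ] ∑[ x ∈ xs ] f x y
∑-swap [] ys f = ≡.sym (∑-zero ys)
∑-swap (x ∷ xs) ys f =
  trans (cong (∑ ys (f x) +_) (∑-swap xs ys f)) (≡.sym (∑-+ ys (f x) _))

∑-++ : ∀ (xs ys : List A) (f : A → ℕ) → ∑ (xs ++ ys) f ≡ ∑ xs f + ∑ ys f
∑-++ [] ys f = refl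
∑-++ (x ∷ xs) ys f = trans (cong (f x +_) (∑-++ xs ys f)) (≡.sym (+-assoc (f x) _ _))

∑-map : ∀ (h : B → A) (xs : List B) (f : A → ℕ) → ∑ (map h xs) f ≡ ∑ xs (f ∘ h)
∑-map h [] f = refl
∑-map h (x ∷ xs) f = cong (f (h x) +_) (∑-map h xs f)

∑-cartesianProductWith : ∀ {C : Set} (h : A → B → C) xs ys (f : C → ℕ) →
  ∑ (cartesianProductWith h xs ys) f ≡ ∑[ x ∈ xs ] ∑[ y ∈ ys ] f (h x y)
∑-cartesianProductWith h [] ys f = refl
∑-cartesianProductWith h (x ∷ xs) ys f =
  trans (∑-++ (map (h x) ys) _ f)
    (cong₂ _+_ (∑-map (h x) ys f) (∑-cartesianProductWith h xs ys f))

∑-allFin : ∀ n (f : Fin (suc n) → ℕ) → ∑ (allFin (suc n)) f ≡ f zero + ∑ (allFin n) (f ∘ suc)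
∑-allFin n f = cong (f zero +_)
  (trans (cong (λ l → ∑ l f) (≡.sym (map-tabulate id suc))) (∑-map suc (allFin n) f))

-- Enumerated types and reindexing of sums.

-- `once` expresses occurring exactly once as an indicator sum, the form in which `sift` consumes
-- it.
record Enum (A : Set) : Set where
  infix 4 _≟_
  field
    elems : List A
    _≟_ : DecidableEquality A

  δ : A → A → ℕ
  δ x y = ⟦ does (x ≟ y) ⟧

  field
    once : ∀ a → ∑[ x ∈ elems ] δ x a ≡ 1

  δ-refl : ∀ x → δ x x ≡ 1
  δ-refl x with x ≟ x
  ... | yes _ = refl
  ... | no x≢x = ⊥-elim (x≢x refl)

  δ-≢ : ∀ {x y} → x ≢ y → δ x y ≡ 0
  δ-≢ {x} {y} x≢y with x ≟ y
  ... | yes x≡y = ⊥-elim (x≢y x≡y)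
  ... | no _ = refl

  sift : ∀ a (f : A → ℕ) → ∑[ x ∈ elems ] δ x a * f x ≡ f a
  sift a f = begin
    ∑[ x ∈ elems ] δ x a * f x  ≡⟨ ∑-cong elems at-a ⟩
    ∑[ x ∈ elems ] δ x a * f a  ≡⟨ ∑-* elems _ (f a) ⟨
    (∑[ x ∈ elems ] δ x a) * f a  ≡⟨ cong (_* f a) (once a) ⟩
    1 * f a                       ≡⟨ *-identityˡ (f a) ⟩
    f a                           ∎
    where
    open ≡-Reasoning
    at-a : ∀ x → δ x a * f x ≡ δ x a * f a
    at-a x with x ≟ a
    ... | yes refl = refl
    ... | no _ = refl

  ∑≡0⇒≡0 : ∀ (f : A → ℕ) → ∑ elems f ≡ 0 → ∀ a → f a ≡ 0
  ∑≡0⇒≡0 f e a = n≤0⇒n≡0 (begin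
    f a                            ≡⟨ sift a f ⟨
    ∑[ x ∈ elems ] δ x a * f x  ≤⟨ ∑-mono-≤ elems below ⟩
    ∑ elems f                    ≡⟨ e ⟩
    0                            ∎)
    where
    open ≤-Reasoning
    below : ∀ x → δ x a * f x ≤ f x
    below x with x ≟ a
    ... | yes _ = ≤-reflexive (*-identityˡ (f x))
    ... | no _ = z≤n

open Enum using (elems)

-- Write each term as a sum over `y` with the indicator of `y ≡ f x`, exchange the sums and sift at
-- `x ≡ g y`. The maps are inverse only on `p` and `q`, as in `InducedIso` and `SameDeck`, which
-- leave them arbitrary elsewhere.
∑-reindex : (X : Enum A) (Y : Enum B) (p : A → Bool) (q : B → Bool) (f : A → B) (g : B → A) →
  (∀ x → p x ≡ true → q (f x) ≡ true) → (∀ y → q y ≡ true → p (g y) ≡ true) →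
  (∀ x → p x ≡ true → g (f x) ≡ x) → (∀ y → q y ≡ true → f (g y) ≡ y) →
  (F : A → ℕ) (F′ : B → ℕ) → (∀ x → p x ≡ true → F x ≡ F′ (f x)) →
  ∑[ x ∈ elems X ] ⟦ p x ⟧ * F x ≡ ∑[ y ∈ elems Y ] ⟦ q y ⟧ * F′ y
∑-reindex X Y p q f g pq qp gf fg F F′ FF′ = begin
  ∑[ x ∈ elems X ] ⟦ p x ⟧ * F x
    ≡⟨ ∑-cong (elems X) (λ x → ≡.sym (Enum.sift Y (f x) (λ _ → ⟦ p x ⟧ * F x))) ⟩
  ∑[ x ∈ elems X ] ∑[ y ∈ elems Y ] Enum.δ Y y (f x) * (⟦ p x ⟧ * F x)
    ≡⟨ ∑-swap (elems X) (elems Y) _ ⟩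
  ∑[ y ∈ elems Y ] ∑[ x ∈ elems X ] Enum.δ Y y (f x) * (⟦ p x ⟧ * F x)
    ≡⟨ ∑-cong (elems Y) (λ y → trans (∑-cong (elems X) (pointwise y)) (Enum.sift X (g y) _)) ⟩
  ∑[ y ∈ elems Y ] ⟦ q y ⟧ * F′ y ∎
  where
  open ≡-Reasoning
  pointwise : ∀ y x →
    Enum.δ Y y (f x) * (⟦ p x ⟧ * F x) ≡ Enum.δ X x (g y) * (⟦ q y ⟧ * F′ y)
  -- If just one of `p x` and `q y` holds, the side carrying it has indicator 0 and the other side
  -- has factor 0. If both hold, the equations `y ≡ f x` and `x ≡ g y` are equivalent.
  pointwise y x with p x in px | q y in qy
  ... | false | false = trans (*-zeroʳ (Enum.δ Y y (f x))) (≡.sym (*-zeroʳ (Enum.δ X x (g y))))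
  ... | false | true = trans (*-zeroʳ (Enum.δ Y y (f x)))
    (≡.sym (cong (_* (1 * F′ y)) (Enum.δ-≢ X (λ x≡gy → Bool.not-¬ (trans (≡.sym px) (trans (cong p x≡gy) (qp y qy))) refl))))
  ... | true | false = trans
    (cong (_* (1 * F x)) (Enum.δ-≢ Y (λ y≡fx → Bool.not-¬ (trans (≡.sym qy) (trans (cong q y≡fx) (pq x px))) refl)))
    (≡.sym (*-zeroʳ (Enum.δ X x (g y))))
  ... | true | true with Enum._≟_ X x (g y)
  ... | yes x≡gy = begin
    Enum.δ Y y (f x) * (1 * F x)
      ≡⟨ cong₂ (λ z c → Enum.δ Y z (f x) * (1 * c)) (trans (≡.sym (fg y qy)) (cong f (≡.sym x≡gy))) (FF′ x px) ⟩
    Enum.δ Y (f x) (f x) * (1 * F′ (f x))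
      ≡⟨ cong₂ (λ d z → d * (1 * F′ z)) (Enum.δ-refl Y (f x)) (trans (cong f x≡gy) (fg y qy)) ⟩
    1 * (1 * F′ y) ∎
  ... | no x≢gy = cong (_* (1 * F x))
    (Enum.δ-≢ Y (λ y≡fx → x≢gy (trans (≡.sym (gf x px)) (cong g (≡.sym y≡fx)))))

boolEnum : Enum Bool
boolEnum = record { elems = true ∷ false ∷ [] ; _≟_ = Bool._≟_ ; once = λ { true → refl ; false → refl } }

finEnum : ∀ n → Enum (Fin n)
finEnum n = record { elems = allFin n ; _≟_ = Fin._≟_ ; once = once n }
  where
  once : ∀ n (a : Fin n) → ∑[ x ∈ allFin n ] ⟦ does (x Fin.≟ a) ⟧ ≡ 1
  once (suc n) zero = trans (∑-allFin n (λ x → ⟦ does (x Fin.≟ zero) ⟧)) (cong suc (∑-zero (allFin n)))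
  once (suc n) (suc a) = trans (∑-allFin n (λ x → ⟦ does (x Fin.≟ suc a) ⟧)) (once n a)

vectors : List A → ∀ m → List (Vec A m)
vectors xs zero = [] ∷ []
vectors xs (suc m) = cartesianProductWith _∷_ xs (vectors xs m)

∑-vectors : ∀ (xs : List A) m (f : Vec A (suc m) → ℕ) →
  ∑ (vectors xs (suc m)) f ≡ ∑[ x ∈ xs ] ∑[ t ∈ vectors xs m ] f (x ∷ t)
∑-vectors xs m f = ∑-cartesianProductWith _∷_ xs (vectors xs m) f

vecEnum : Enum A → ∀ m → Enum (Vec A m)
vecEnum X m = record { elems = vectors (elems X) m ; _≟_ = Vec.≡-dec (Enum._≟_ X) ; once = once }
  where
  once : ∀ {m} (a : Vec _ m) → ∑[ t ∈ vectors (elems X) m ] ⟦ does (Vec.≡-dec (Enum._≟_ X) t a) ⟧ ≡ 1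
  once [] = refl
  once {suc m} (a ∷ as) = begin
    ∑[ t ∈ vectors (elems X) (suc m) ] ⟦ does (Vec.≡-dec (Enum._≟_ X) t (a ∷ as)) ⟧
      ≡⟨ ∑-vectors (elems X) m _ ⟩
    ∑[ x ∈ elems X ] ∑[ t ∈ vectors (elems X) m ] ⟦ does (Enum._≟_ X x a) ∧ does (Vec.≡-dec (Enum._≟_ X) t as) ⟧
      ≡⟨ ∑-cong (elems X) (λ x → trans (∑-cong (vectors (elems X) m) (λ t → ⟦∧⟧ (does (Enum._≟_ X x a)) _))
           (≡.sym (*-∑ (Enum.δ X x a) (vectors (elems X) m) _))) ⟩
    ∑[ x ∈ elems X ] Enum.δ X x a * (∑[ t ∈ vectors (elems X) m ] ⟦ does (Vec.≡-dec (Enum._≟_ X) t as) ⟧)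
      ≡⟨ Enum.sift X a _ ⟩
    ∑[ t ∈ vectors (elems X) m ] ⟦ does (Vec.≡-dec (Enum._≟_ X) t as) ⟧
      ≡⟨ once as ⟩
    1 ∎
    where open ≡-Reasoning

-- Counting the `k`-subsets above a given subset.

-- The number of k-subsets of a (p + o)-set that contain a given p-subset.
supersets : (o p k : ℕ) → ℕ
supersets zero p k = ⟦ p ≡ᵇ k ⟧
supersets (suc o) p zero = supersets o p zero
supersets (suc o) p (suc k) = supersets o p k + supersets o p (suc k)

supersets-suc-zero : ∀ o p → supersets o (suc p) zero ≡ 0
supersets-suc-zero zero p = refl
supersets-suc-zero (suc o) p = supersets-suc-zero o p

-- The count is the number of ways to choose `k - p` out of `o` elements, so only the difference of
-- `k` and `p` matters.
supersets-suc-suc : ∀ o p k → supersets o (suc p) (suc k) ≡ supersets o p k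
supersets-suc-suc zero p k = refl
supersets-suc-suc (suc o) p zero =
  cong₂ _+_ (supersets-suc-zero o p) (supersets-suc-suc o p zero)
supersets-suc-suc (suc o) p (suc k) =
  cong₂ _+_ (supersets-suc-suc o p k) (supersets-suc-suc o p (suc k))

-- Positivity lets Kelly's lemma cancel the count. An outside element is left out of the subset as
-- long as the remaining ones suffice, and put in otherwise.
supersets-positive : ∀ o p k → p ≤ k → k ≤ p + o → 1 ≤ supersets o p k
supersets-positive zero p k p≤k k≤p
  rewrite ≤-antisym p≤k (subst (k ≤_) (+-identityʳ p) k≤p) = ≤-reflexive (≡.sym (≡ᵇ-refl k))
  where
  ≡ᵇ-refl : ∀ k → ⟦ k ≡ᵇ k ⟧ ≡ 1
  ≡ᵇ-refl zero = refl
  ≡ᵇ-refl (suc k) = ≡ᵇ-refl k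
supersets-positive (suc o) zero zero p≤k k≤n = supersets-positive o zero zero z≤n z≤n
supersets-positive (suc o) p (suc k) p≤k k≤n with suc k ≤? p + o
... | yes k<p+o = ≤-trans (supersets-positive o p (suc k) p≤k k<p+o) (m≤n+m _ (supersets o p k))
... | no k≮p+o = ≤-trans (supersets-positive o p k p≤k′ k≤p+o) (m≤m+n _ _)
  where
  p≤k′ : p ≤ k
  p≤k′ = ≤-trans (m≤m+n p o) (≤-pred (≰⇒> k≮p+o))
  k≤p+o : k ≤ p + o
  k≤p+o = ≤-pred (subst (suc k ≤_) (+-suc p o) k≤n)

subsetEnum : ∀ n → Enum (Subset n)
subsetEnum = vecEnum boolEnum

tupleEnum : ∀ n m → Enum (Vec (Fin n) m)
tupleEnum n = vecEnum (finEnum n)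

_⊑_ : ∀ {n} → Subset n → Subset n → Bool
[] ⊑ [] = true
(true ∷ T) ⊑ (s ∷ S) = s ∧ (T ⊑ S)
(false ∷ T) ⊑ (s ∷ S) = T ⊑ S

∑-subsets : ∀ n (f : Subset (suc n) → ℕ) → ∑ (elems (subsetEnum (suc n))) f ≡
  (∑[ S ∈ elems (subsetEnum n) ] f (true ∷ S)) + (∑[ S ∈ elems (subsetEnum n) ] f (false ∷ S))
∑-subsets n f = trans (∑-vectors (elems boolEnum) n f)
  (cong (∑ (elems (subsetEnum n)) (f ∘ (true ∷_)) +_) (+-identityʳ _))

-- Elements of `T` are forced into `S`, so `p` and `k` drop together; an element outside `T` gives
-- the Pascal step of `supersets`.
∑-supersets : ∀ {n} (T : Subset n) k →
  ∑[ S ∈ elems (subsetEnum n) ] ⟦ ∣ S ∣ ≡ᵇ k ⟧ * ⟦ T ⊑ S ⟧ ≡ supersets (n ∸ ∣ T ∣) ∣ T ∣ k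
∑-supersets {zero} [] k = trans (+-identityʳ _) (*-identityʳ _)
∑-supersets {suc n} (true ∷ T) zero = trans (∑-subsets n _)
  (trans (cong₂ _+_ (∑-zero (elems (subsetEnum n)))
            (trans (∑-cong (elems (subsetEnum n)) (λ S → *-zeroʳ ⟦ ∣ S ∣ ≡ᵇ 0 ⟧)) (∑-zero (elems (subsetEnum n)))))
    (≡.sym (supersets-suc-zero (n ∸ ∣ T ∣) ∣ T ∣)))
∑-supersets {suc n} (true ∷ T) (suc k) = trans (∑-subsets n _)
  (trans (cong₂ _+_ (∑-supersets T k)
            (trans (∑-cong (elems (subsetEnum n)) (λ S → *-zeroʳ ⟦ ∣ S ∣ ≡ᵇ suc k ⟧)) (∑-zero (elems (subsetEnum n)))))
    (trans (+-identityʳ _) (≡.sym (supersets-suc-suc (n ∸ ∣ T ∣) ∣ T ∣ k))))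
-- The rewrite exposes the successor in `suc n ∸ ∣ T ∣`, so that `supersets` unfolds.
∑-supersets {suc n} (false ∷ T) k rewrite +-∸-assoc 1 (∣p∣≤n T) = trans (∑-subsets n _) (split k)
  where
  split : ∀ k → (∑[ S ∈ elems (subsetEnum n) ] ⟦ suc ∣ S ∣ ≡ᵇ k ⟧ * ⟦ T ⊑ S ⟧)
    + (∑[ S ∈ elems (subsetEnum n) ] ⟦ ∣ S ∣ ≡ᵇ k ⟧ * ⟦ T ⊑ S ⟧) ≡ supersets (suc (n ∸ ∣ T ∣)) ∣ T ∣ k
  split zero = cong₂ _+_ (∑-zero (elems (subsetEnum n))) (∑-supersets T zero)
  split (suc k) = cong₂ _+_ (∑-supersets T k) (∑-supersets T (suc k))

-- Tuples of vertices and the sets they cover.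

-- Entries may repeat, so a tuple of length `m` can cover fewer than `m` vertices; how many cards
-- contain it depends on the size of this set.
image : ∀ {n m} → Vec (Fin n) m → Subset n
image [] = ⊥
image (v ∷ t) = image t [ v ]≔ true

within : ∀ {n m} → Subset n → Vec (Fin n) m → Bool
within S [] = true
within S (v ∷ t) = lookup S v ∧ within S t

⊥-⊑ : ∀ {n} (S : Subset n) → ⊥ ⊑ S ≡ true
⊥-⊑ [] = refl
⊥-⊑ (s ∷ S) = ⊥-⊑ S

insert-⊑ : ∀ {n} (T S : Subset n) v → (T [ v ]≔ true) ⊑ S ≡ lookup S v ∧ (T ⊑ S)
insert-⊑ (true ∷ T) (true ∷ S) zero = refl
insert-⊑ (true ∷ T) (false ∷ S) zero = refl
insert-⊑ (false ∷ T) (s ∷ S) zero = refl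
insert-⊑ (true ∷ T) (true ∷ S) (suc v) = insert-⊑ T S v
insert-⊑ (true ∷ T) (false ∷ S) (suc v) = ≡.sym (Bool.∧-zeroʳ (lookup S v))
insert-⊑ (false ∷ T) (s ∷ S) (suc v) = insert-⊑ T S v

image-⊑ : ∀ {n m} (t : Vec (Fin n) m) S → image t ⊑ S ≡ within S t
image-⊑ [] S = ⊥-⊑ S
image-⊑ (v ∷ t) S = trans (insert-⊑ (image t) S v) (cong (lookup S v ∧_) (image-⊑ t S))

∣insert∣ : ∀ {n} (T : Subset n) v → ⟦ lookup T v ⟧ + ∣ T [ v ]≔ true ∣ ≡ suc ∣ T ∣
∣insert∣ (true ∷ T) zero = refl
∣insert∣ (false ∷ T) zero = refl
∣insert∣ (true ∷ T) (suc v) = trans (+-suc ⟦ lookup T v ⟧ _) (cong suc (∣insert∣ T v))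
∣insert∣ (false ∷ T) (suc v) = ∣insert∣ T v

∣image∣≤ : ∀ {n m} (t : Vec (Fin n) m) → ∣ image t ∣ ≤ m
∣image∣≤ {n} [] = ≤-reflexive (∣⊥∣≡0 n)
∣image∣≤ {m = suc m} (v ∷ t) = begin
  ∣ image t [ v ]≔ true ∣                              ≤⟨ m≤n+m _ ⟦ lookup (image t) v ⟧ ⟩
  ⟦ lookup (image t) v ⟧ + ∣ image t [ v ]≔ true ∣  ≡⟨ ∣insert∣ (image t) v ⟩
  suc ∣ image t ∣                                      ≤⟨ s≤s (∣image∣≤ t) ⟩
  suc m                                                 ∎
  where open ≤-Reasoning

InjectiveOn : ∀ {n} → Subset n → (Fin n → Fin n) → Set
InjectiveOn S f = ∀ x y → lookup S x ≡ true → lookup S y ≡ true → f x ≡ f y → x ≡ y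

PreservesAdjOn : ∀ {n} → Graph n → Graph n → Subset n → (Fin n → Fin n) → Set
PreservesAdjOn G H S f = ∀ x y → lookup S x ≡ true → lookup S y ≡ true → adj G x y ≡ adj H (f x) (f y)

∧-true : ∀ {a b} → a ∧ b ≡ true → a ≡ true × b ≡ true
∧-true {true} {true} refl = refl , refl

lookup-image-map : ∀ {n m} {S : Subset n} {f} → InjectiveOn S f → (t : Vec (Fin n) m) → within S t ≡ true →
  ∀ v → lookup S v ≡ true → lookup (image t) v ≡ lookup (image (Vec.map f t)) (f v)
lookup-image-map {f = f} inj [] _ v _ =
  trans (Vec.lookup-replicate v false) (≡.sym (Vec.lookup-replicate (f v) false))
lookup-image-map {f = f} inj (w ∷ t) tS v vS with v Fin.≟ w | ∧-true tS
... | yes refl | wS , tS′ = trans (Vec.lookup∘updateAt v (image t))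
  (≡.sym (Vec.lookup∘updateAt (f v) (image (Vec.map f t))))
... | no v≢w | wS , tS′ = trans (Vec.lookup∘updateAt′ v w v≢w (image t))
  (trans (lookup-image-map inj t tS′ v vS)
    (≡.sym (Vec.lookup∘updateAt′ (f v) (f w) (v≢w ∘ inj v w vS wS) (image (Vec.map f t)))))

-- By `lookup-image-map`, a vertex repeats an entry of `t` exactly when its image repeats an entry
-- of `Vec.map f t`. Injectivity on `S` is enough because all entries lie in `S`.
∣image-map∣ : ∀ {n m} {S : Subset n} {f} → InjectiveOn S f → (t : Vec (Fin n) m) → within S t ≡ true →
  ∣ image t ∣ ≡ ∣ image (Vec.map f t) ∣
∣image-map∣ inj [] _ = refl
∣image-map∣ {f = f} inj (v ∷ t) tS with ∧-true tS
... | vS , tS′ = +-cancelˡ-≡ ⟦ lookup (image t) v ⟧ _ _ (begin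
  ⟦ lookup (image t) v ⟧ + ∣ image (v ∷ t) ∣
    ≡⟨ ∣insert∣ (image t) v ⟩
  suc ∣ image t ∣
    ≡⟨ cong suc (∣image-map∣ inj t tS′) ⟩
  suc ∣ image (Vec.map f t) ∣
    ≡⟨ ∣insert∣ (image (Vec.map f t)) (f v) ⟨
  ⟦ lookup (image (Vec.map f t)) (f v) ⟧ + ∣ image (Vec.map f (v ∷ t)) ∣
    ≡⟨ cong (λ b → ⟦ b ⟧ + ∣ image (Vec.map f (v ∷ t)) ∣) (≡.sym (lookup-image-map inj t tS′ v vS)) ⟩
  ⟦ lookup (image t) v ⟧ + ∣ image (Vec.map f (v ∷ t)) ∣ ∎)
  where open ≡-Reasoning

-- Local weights, cards and Kelly's lemma.

Weight : ℕ → ℕ → Set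
Weight n m = Graph n → Vec (Fin n) m → ℕ

-- Invariance under embeddings of any induced subgraph containing the tuple: the weight sees only
-- equalities and adjacencies among the entries, which is what a card retains.
Local : ∀ {n m} → Weight n m → Set
Local {n} {m} ω = ∀ (G H : Graph n) S f → InjectiveOn S f → PreservesAdjOn G H S f →
  ∀ t → within S t ≡ true → ω G t ≡ ω H (Vec.map f t)

∑-card : ∀ {n m} → Weight n m → Graph n → Subset n → ℕ
∑-card {n} {m} ω G S = ∑[ t ∈ elems (tupleEnum n m) ] ⟦ within S t ⟧ * ω G t

within-map : ∀ {n m} {S T : Subset n} {f} → (∀ x → lookup S x ≡ true → lookup T (f x) ≡ true) →
  (t : Vec (Fin n) m) → within S t ≡ true → within T (Vec.map f t) ≡ true
within-map ST [] _ = refl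
within-map ST (v ∷ t) tS with ∧-true tS
... | vS , tS′ rewrite ST v vS = within-map ST t tS′

map-inverse : ∀ {n m} {S : Subset n} {f g : Fin n → Fin n} → (∀ x → lookup S x ≡ true → g (f x) ≡ x) →
  (t : Vec (Fin n) m) → within S t ≡ true → Vec.map g (Vec.map f t) ≡ t
map-inverse gf [] _ = refl
map-inverse gf (v ∷ t) tS with ∧-true tS
... | vS , tS′ = cong₂ _∷_ (gf v vS) (map-inverse gf t tS′)

-- InducedIso with membership expressed by lookup.
record CardIso {n} (G : Graph n) (S : Subset n) (H : Graph n) (T : Subset n) : Set where
  field
    to from : Fin n → Fin n
    to-∈ : ∀ x → lookup S x ≡ true → lookup T (to x) ≡ true
    from-∈ : ∀ y → lookup T y ≡ true → lookup S (from y) ≡ true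
    from-to : ∀ x → lookup S x ≡ true → from (to x) ≡ x
    to-from : ∀ y → lookup T y ≡ true → to (from y) ≡ y
    to-adj : PreservesAdjOn G H S to

  to-injective : InjectiveOn S to
  to-injective x y xS yS e = trans (≡.sym (from-to x xS)) (trans (cong from e) (from-to y yS))

cardIso : ∀ {n} {G H : Graph n} {S T} → InducedIso G S H T → CardIso G S H T
cardIso {S = S} {T} (f , g , fT , gS , gf , fg , fadj) = record
  { to = f ; from = g
  ; to-∈ = λ x xS → Vec.[]=⇒lookup (fT x (Vec.lookup⇒[]= x S xS))
  ; from-∈ = λ y yT → Vec.[]=⇒lookup (gS y (Vec.lookup⇒[]= y T yT))
  ; from-to = λ x xS → gf x (Vec.lookup⇒[]= x S xS)
  ; to-from = λ y yT → fg y (Vec.lookup⇒[]= y T yT)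
  ; to-adj = λ x y xS yS → fadj x y (Vec.lookup⇒[]= x S xS) (Vec.lookup⇒[]= y S yS)
  }

∑-card-iso : ∀ {n m} {ω : Weight n m} → Local ω → ∀ {G H S T} → CardIso G S H T →
  ∑-card ω G S ≡ ∑-card ω H T
∑-card-iso {n} {m} {ω} local {G} {H} {S} {T} φ =
  ∑-reindex (tupleEnum n m) (tupleEnum n m) (within S) (within T) (Vec.map to) (Vec.map from)
    (within-map to-∈) (within-map from-∈) (map-inverse from-to) (map-inverse to-from)
    (ω G) (ω H) (local G H S to to-injective to-adj)
  where open CardIso φ

≡ᵇ-true⇒≡ : ∀ {a b} → (a ≡ᵇ b) ≡ true → a ≡ b
≡ᵇ-true⇒≡ {a} {b} e = ≡ᵇ⇒≡ a b (subst T (≡.sym e) tt)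

≡⇒≡ᵇ-true : ∀ {a b} → a ≡ b → (a ≡ᵇ b) ≡ true
≡⇒≡ᵇ-true {zero} refl = refl
≡⇒≡ᵇ-true {suc a} refl = ≡⇒≡ᵇ-true {a} refl

∑-deck : ∀ {n k m} {G H : Graph n} {ω : Weight n m} → Local ω → SameDeck k G H →
  ∑[ S ∈ elems (subsetEnum n) ] ⟦ ∣ S ∣ ≡ᵇ k ⟧ * ∑-card ω G S ≡
  ∑[ S ∈ elems (subsetEnum n) ] ⟦ ∣ S ∣ ≡ᵇ k ⟧ * ∑-card ω H S
∑-deck {n} {k} {G = G} {H} {ω} local (φ , ψ , φ-size , ψ-size , ψφ , φψ , iso) =
  ∑-reindex (subsetEnum n) (subsetEnum n) (λ S → ∣ S ∣ ≡ᵇ k) (λ S → ∣ S ∣ ≡ᵇ k) φ ψ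
    (λ S e → ≡⇒≡ᵇ-true (φ-size S (≡ᵇ-true⇒≡ e))) (λ S e → ≡⇒≡ᵇ-true (ψ-size S (≡ᵇ-true⇒≡ e)))
    (λ S e → ψφ S (≡ᵇ-true⇒≡ e)) (λ S e → φψ S (≡ᵇ-true⇒≡ e))
    (∑-card ω G) (∑-card ω H)
    (λ S e → ∑-card-iso local (cardIso (iso S (≡ᵇ-true⇒≡ e))))

-- Double counting: after the sums are exchanged, each tuple is counted once for every `k`-set
-- containing its image.
∑-deck-supersets : ∀ {n m} k (ω : Weight n m) G →
  ∑[ S ∈ elems (subsetEnum n) ] ⟦ ∣ S ∣ ≡ᵇ k ⟧ * ∑-card ω G S ≡
  ∑[ t ∈ elems (tupleEnum n m) ] supersets (n ∸ ∣ image t ∣) ∣ image t ∣ k * ω G t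
∑-deck-supersets {n} {m} k ω G = begin
  ∑[ S ∈ Ss ] ⟦ ∣ S ∣ ≡ᵇ k ⟧ * ∑-card ω G S
    ≡⟨ ∑-cong Ss (λ S → *-∑ ⟦ ∣ S ∣ ≡ᵇ k ⟧ ts _) ⟩
  ∑[ S ∈ Ss ] ∑[ t ∈ ts ] ⟦ ∣ S ∣ ≡ᵇ k ⟧ * (⟦ within S t ⟧ * ω G t)
    ≡⟨ ∑-swap Ss ts _ ⟩
  ∑[ t ∈ ts ] ∑[ S ∈ Ss ] ⟦ ∣ S ∣ ≡ᵇ k ⟧ * (⟦ within S t ⟧ * ω G t)
    ≡⟨ ∑-cong ts (λ t → ∑-cong Ss (λ S → trans
         (cong (λ b → ⟦ ∣ S ∣ ≡ᵇ k ⟧ * (⟦ b ⟧ * ω G t)) (≡.sym (image-⊑ t S)))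
         (≡.sym (*-assoc ⟦ ∣ S ∣ ≡ᵇ k ⟧ ⟦ image t ⊑ S ⟧ (ω G t))))) ⟩
  ∑[ t ∈ ts ] ∑[ S ∈ Ss ] (⟦ ∣ S ∣ ≡ᵇ k ⟧ * ⟦ image t ⊑ S ⟧) * ω G t
    ≡⟨ ∑-cong ts (λ t → trans (≡.sym (∑-* Ss _ (ω G t))) (cong (_* ω G t) (∑-supersets (image t) k))) ⟩
  ∑[ t ∈ ts ] supersets (n ∸ ∣ image t ∣) ∣ image t ∣ k * ω G t ∎
  where
  open ≡-Reasoning
  Ss = elems (subsetEnum n)
  ts = elems (tupleEnum n m)

rank : ∀ {n m} → Vec (Fin n) m → Fin (suc m)
rank t = fromℕ< (s≤s (∣image∣≤ t))

-- Kelly's lemma: splitting by the size q of the image, every tuple lies in the same positive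
-- number of k-subsets.
∑-tuples : ∀ {n k m} {G H : Graph n} → k ≤ n → SameDeck k G H → m ≤ k →
  (ω : Weight n m) → Local ω →
  ∑ (elems (tupleEnum n m)) (ω G) ≡ ∑ (elems (tupleEnum n m)) (ω H)
∑-tuples {n} {k} {m} {G} {H} k≤n deck m≤k ω local =
  trans (by-rank G) (trans (∑-cong (allFin (suc m)) same) (≡.sym (by-rank H)))
  where
  open ≡-Reasoning
  ts = elems (tupleEnum n m)

  ω-rank : Fin (suc m) → Weight n m
  ω-rank q G t = Enum.δ (finEnum (suc m)) q (rank t) * ω G t

  ω-rank-local : ∀ q → Local (ω-rank q)
  ω-rank-local q G H S f inj pres t tS = cong₂ (λ r w → Enum.δ (finEnum (suc m)) q r * w)
    (Fin.fromℕ<-cong _ _ (∣image-map∣ inj t tS) (s≤s (∣image∣≤ t)) (s≤s (∣image∣≤ (Vec.map f t))))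
    (local G H S f inj pres t tS)

  by-rank : ∀ G → ∑ ts (ω G) ≡ ∑[ q ∈ allFin (suc m) ] ∑ ts (ω-rank q G)
  by-rank G = trans
    (∑-cong ts (λ t → ≡.sym (Enum.sift (finEnum (suc m)) (rank t) (λ _ → ω G t))))
    (∑-swap ts (allFin (suc m)) _)

  number : Fin (suc m) → ℕ
  number q = supersets (n ∸ toℕ q) (toℕ q) k

  -- Here `m ≤ k` matters: an image larger than a card would be counted zero times.
  number-positive : ∀ q → 1 ≤ number q
  number-positive q = supersets-positive (n ∸ toℕ q) (toℕ q) k q≤k
    (subst (k ≤_) (≡.sym (m+[n∸m]≡n (≤-trans q≤k k≤n))) k≤n)
    where
    q≤k : toℕ q ≤ k
    q≤k = ≤-trans (≤-pred (Fin.toℕ<n q)) m≤k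

  scaled : ∀ q G → number q * ∑ ts (ω-rank q G) ≡
    ∑[ S ∈ elems (subsetEnum n) ] ⟦ ∣ S ∣ ≡ᵇ k ⟧ * ∑-card (ω-rank q) G S
  scaled q G = begin
    number q * ∑ ts (ω-rank q G)
      ≡⟨ *-∑ (number q) ts _ ⟩
    ∑[ t ∈ ts ] number q * ω-rank q G t
      ≡⟨ ∑-cong ts pointwise ⟩
    ∑[ t ∈ ts ] supersets (n ∸ ∣ image t ∣) ∣ image t ∣ k * ω-rank q G t
      ≡⟨ ∑-deck-supersets k (ω-rank q) G ⟨
    ∑[ S ∈ elems (subsetEnum n) ] ⟦ ∣ S ∣ ≡ᵇ k ⟧ * ∑-card (ω-rank q) G S ∎
    where
    pointwise : ∀ t → number q * ω-rank q G t ≡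
      supersets (n ∸ ∣ image t ∣) ∣ image t ∣ k * ω-rank q G t
    pointwise t with q Fin.≟ rank t
    ... | yes refl = cong (λ p → supersets (n ∸ p) p k * (1 * ω G t))
      (Fin.toℕ-fromℕ< (s≤s (∣image∣≤ t)))
    ... | no _ = trans (*-zeroʳ (number q)) (≡.sym (*-zeroʳ (supersets (n ∸ ∣ image t ∣) ∣ image t ∣ k)))

  same : ∀ q → ∑ ts (ω-rank q G) ≡ ∑ ts (ω-rank q H)
  same q = *-cancelˡ-≡ _ _ (number q) {{≢-nonZero (λ e → n≮0 (subst (1 ≤_) e (number-positive q)))}}
    (trans (scaled q G) (trans (∑-deck (ω-rank-local q) deck) (≡.sym (scaled q H))))

-- Transferring values through their moments.

-- The gaps `g a ∸ f a` sum to zero.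
∑-≤-tight : ∀ {A : Set} (X : Enum A) (f g : A → ℕ) → (∀ a → f a ≤ g a) →
  ∑ (elems X) f ≡ ∑ (elems X) g → ∀ a → f a ≡ g a
∑-≤-tight X f g f≤g e a = ≤-antisym (f≤g a)
  (m∸n≡0⇒m≤n (Enum.∑≡0⇒≡0 X (λ a → g a ∸ f a) gap≡0 a))
  where
  gap≡0 : ∑[ a ∈ elems X ] g a ∸ f a ≡ 0
  gap≡0 = +-cancelˡ-≡ (∑ (elems X) f) _ _ (begin
    ∑ (elems X) f + (∑[ a ∈ elems X ] g a ∸ f a)  ≡⟨ ∑-+ (elems X) f _ ⟨
    ∑[ a ∈ elems X ] f a + (g a ∸ f a)              ≡⟨ ∑-cong (elems X) (λ a → m+[n∸m]≡n (f≤g a)) ⟩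
    ∑ (elems X) g                                     ≡⟨ e ⟨
    ∑ (elems X) f                                     ≡⟨ +-identityʳ _ ⟨
    ∑ (elems X) f + 0 ∎)
    where open ≡-Reasoning

-- The expansion of a squared difference, with the cross term moved to the left because natural
-- subtraction truncates.
square-∣-∣ : ∀ x y → ∣ x - y ∣ * ∣ x - y ∣ + 2 * (x * y) ≡ x * x + y * y
square-∣-∣ x y with ≤-total x y
... | inj₁ x≤y rewrite m≤n⇒∣m-n∣≡n∸m x≤y =
  subst (λ z → (y ∸ x) * (y ∸ x) + 2 * (x * z) ≡ x * x + z * z) (m+[n∸m]≡n x≤y) (expand x (y ∸ x))
  where
  expand : ∀ x d → d * d + 2 * (x * (x + d)) ≡ x * x + (x + d) * (x + d)
  expand = solve-∀
... | inj₂ y≤x rewrite m≤n⇒∣n-m∣≡n∸m y≤x =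
  subst (λ z → (x ∸ y) * (x ∸ y) + 2 * (z * y) ≡ z * z + y * y) (m+[n∸m]≡n y≤x) (expand y (x ∸ y))
  where
  expand : ∀ y d → d * d + 2 * ((y + d) * y) ≡ (y + d) * (y + d) + y * y
  expand = solve-∀

-- `w` selects the index tuples and `value` sums `g` over one further vertex. `value` need not be
-- local, but each of its powers expands into a sum of local weights with one extra vertex per
-- factor; so the moment of order `i` needs cards with at least `s + i` vertices.
module Moments {n k} {G H : Graph n} (k≤n : k ≤ n) (deck : SameDeck k G H)
  {s} (w : Weight n s) (w-local : Local w) (g : Weight n (suc s)) (g-local : Local g) where

  private
    ts = elems (tupleEnum n s)

  value : Graph n → Vec (Fin n) s → ℕ
  value G t = ∑[ y ∈ allFin n ] g G (y ∷ t)

  private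
    ω₁ : Weight n (suc s)
    ω₁ G t = w G (tail t) * g G t

    ω₁-local : Local ω₁
    ω₁-local G H S f inj pres (y ∷ t) ytS = cong₂ _*_
      (w-local G H S f inj pres t (proj₂ (∧-true {lookup S y} ytS)))
      (g-local G H S f inj pres (y ∷ t) ytS)

    -- On `y ∷ y′ ∷ t` the two new vertices range independently and may coincide, so summing over
    -- both yields the square of `value`.
    ω₂ : Weight n (suc (suc s))
    ω₂ G t = g G (head t ∷ tail (tail t)) * ω₁ G (tail t)

    ω₂-local : Local ω₂
    ω₂-local G H S f inj pres (y ∷ y′ ∷ t) tS = cong₂ _*_
      (g-local G H S f inj pres (y ∷ t) ytS)
      (ω₁-local G H S f inj pres (y′ ∷ t) (proj₂ (∧-true {lookup S y} tS)))
      where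
      ytS : within S (y ∷ t) ≡ true
      ytS with ∧-true {lookup S y} tS
      ... | yS , y′tS rewrite yS = proj₂ (∧-true {lookup S y′} y′tS)

    ∑ω₁ : ∀ G → ∑ (elems (tupleEnum n (suc s))) (ω₁ G) ≡ ∑[ t ∈ ts ] w G t * value G t
    ∑ω₁ G = trans (∑-vectors (allFin n) s (ω₁ G))
      (trans (∑-swap (allFin n) ts _) (∑-cong ts (λ t → ≡.sym (*-∑ (w G t) (allFin n) _))))

    ∑ω₂ : ∀ G → ∑ (elems (tupleEnum n (suc (suc s)))) (ω₂ G) ≡
      ∑[ t ∈ ts ] w G t * (value G t * value G t)
    ∑ω₂ G = begin
      ∑ (elems (tupleEnum n (suc (suc s)))) (ω₂ G)
        ≡⟨ trans (∑-vectors (allFin n) (suc s) (ω₂ G)) (∑-cong (allFin n) (λ y → ∑-vectors (allFin n) s _)) ⟩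
      ∑[ y ∈ allFin n ] ∑[ y′ ∈ allFin n ] ∑[ t ∈ ts ] g G (y ∷ t) * (w G t * g G (y′ ∷ t))
        ≡⟨ ∑-cong (allFin n) (λ y → trans (∑-swap (allFin n) ts _) (∑-cong ts (λ t →
             trans (≡.sym (*-∑ (g G (y ∷ t)) (allFin n) _))
               (cong (g G (y ∷ t) *_) (≡.sym (*-∑ (w G t) (allFin n) _)))))) ⟩
      ∑[ y ∈ allFin n ] ∑[ t ∈ ts ] g G (y ∷ t) * (w G t * value G t)
        ≡⟨ ∑-swap (allFin n) ts _ ⟩
      ∑[ t ∈ ts ] ∑[ y ∈ allFin n ] g G (y ∷ t) * (w G t * value G t)
        ≡⟨ ∑-cong ts (λ t → trans (≡.sym (∑-* (allFin n) _ (w G t * value G t)))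
             (rearrange (value G t) (w G t))) ⟩
      ∑[ t ∈ ts ] w G t * (value G t * value G t) ∎
      where
      open ≡-Reasoning
      rearrange : ∀ x w → x * (w * x) ≡ w * (x * x)
      rearrange = solve-∀

  moment₀ : s ≤ k → ∑ ts (w G) ≡ ∑ ts (w H)
  moment₀ s≤k = ∑-tuples k≤n deck s≤k w w-local

  moment₁ : suc s ≤ k → ∑[ t ∈ ts ] w G t * value G t ≡ ∑[ t ∈ ts ] w H t * value H t
  moment₁ s<k = trans (≡.sym (∑ω₁ G)) (trans (∑-tuples k≤n deck s<k ω₁ ω₁-local) (∑ω₁ H))

  moment₂ : suc (suc s) ≤ k →
    ∑[ t ∈ ts ] w G t * (value G t * value G t) ≡ ∑[ t ∈ ts ] w H t * (value H t * value H t)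
  moment₂ s+1<k = trans (≡.sym (∑ω₂ G)) (trans (∑-tuples k≤n deck s+1<k ω₂ ω₂-local) (∑ω₂ H))

  absent-transfer : s ≤ k → (∀ t → w G t ≡ 0) → ∀ t → w H t ≡ 0
  absent-transfer s≤k absent = Enum.∑≡0⇒≡0 (tupleEnum n s) (w H)
    (trans (≡.sym (moment₀ s≤k)) (trans (∑-cong ts absent) (∑-zero ts)))

  -- A pointwise upper bound in `H` together with equal totals forces equality, so no second moment
  -- is involved and one vertex fewer is required than in `constant-transfer`.
  maximum-transfer : suc s ≤ k → ∀ θ → (∀ t → w G t * value G t ≡ w G t * θ) →
    (∀ t → w H t * value H t ≤ w H t * θ) → ∀ t → w H t * value H t ≡ w H t * θ
  maximum-transfer s<k θ G-const H-bound = ∑-≤-tight (tupleEnum n s) _ _ H-bound (begin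
    ∑[ t ∈ ts ] w H t * value H t  ≡⟨ moment₁ s<k ⟨
    ∑[ t ∈ ts ] w G t * value G t  ≡⟨ ∑-cong ts G-const ⟩
    ∑[ t ∈ ts ] w G t * θ          ≡⟨ ∑-* ts (w G) θ ⟨
    ∑ ts (w G) * θ                   ≡⟨ cong (_* θ) (moment₀ (<⇒≤ s<k)) ⟩
    ∑ ts (w H) * θ                   ≡⟨ ∑-* ts (w H) θ ⟩
    ∑[ t ∈ ts ] w H t * θ          ∎)
    where open ≡-Reasoning

  -- The weighted sum of (value − θ)² is determined by the three moments.
  constant-transfer : suc (suc s) ≤ k → ∀ θ → (∀ t → w G t ≢ 0 → value G t ≡ θ) →
    ∀ t → w H t ≢ 0 → value H t ≡ θ
  constant-transfer s+1<k θ G-const t wt≢0 =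
    ∣m-n∣≡0⇒m≡n (square≡0 (*-cancelˡ-≡ _ 0 (w H t) {{≢-nonZero wt≢0}}
      (trans (Enum.∑≡0⇒≡0 (tupleEnum n s) (defect H) defect-H t) (≡.sym (*-zeroʳ (w H t))))))
    where
    open ≡-Reasoning
    defect : Graph n → Vec (Fin n) s → ℕ
    defect G t = w G t * (∣ value G t - θ ∣ * ∣ value G t - θ ∣)

    square≡0 : ∀ {a} → a * a ≡ 0 → a ≡ 0
    square≡0 {zero} _ = refl

    defect-sum : ∀ G → ∑ ts (defect G) + (∑[ t ∈ ts ] w G t * value G t) * (2 * θ) ≡
      (∑[ t ∈ ts ] w G t * (value G t * value G t)) + ∑ ts (w G) * (θ * θ)
    defect-sum G = begin
      ∑ ts (defect G) + (∑[ t ∈ ts ] w G t * value G t) * (2 * θ)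
        ≡⟨ cong (∑ ts (defect G) +_) (∑-* ts _ (2 * θ)) ⟩
      ∑ ts (defect G) + (∑[ t ∈ ts ] w G t * value G t * (2 * θ))
        ≡⟨ ∑-+ ts (defect G) _ ⟨
      ∑[ t ∈ ts ] defect G t + w G t * value G t * (2 * θ)
        ≡⟨ ∑-cong ts (λ t → trans (collect (w G t) (∣ value G t - θ ∣ * ∣ value G t - θ ∣) (value G t) θ)
             (trans (cong (w G t *_) (square-∣-∣ (value G t) θ)) (*-distribˡ-+ (w G t) _ _))) ⟩
      ∑[ t ∈ ts ] w G t * (value G t * value G t) + w G t * (θ * θ)
        ≡⟨ ∑-+ ts _ _ ⟩
      (∑[ t ∈ ts ] w G t * (value G t * value G t)) + (∑[ t ∈ ts ] w G t * (θ * θ))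
        ≡⟨ cong ((∑[ t ∈ ts ] w G t * (value G t * value G t)) +_) (≡.sym (∑-* ts (w G) (θ * θ))) ⟩
      (∑[ t ∈ ts ] w G t * (value G t * value G t)) + ∑ ts (w G) * (θ * θ) ∎
      where
      collect : ∀ w d x θ → w * d + w * x * (2 * θ) ≡ w * (d + 2 * (x * θ))
      collect = solve-∀

    defect-G : ∑ ts (defect G) ≡ 0
    defect-G = trans (∑-cong ts pointwise) (∑-zero ts)
      where
      pointwise : ∀ t → defect G t ≡ 0
      pointwise t with w G t ℕ.≟ 0
      ... | yes wt≡0 rewrite wt≡0 = refl
      ... | no wt≢0 rewrite G-const t wt≢0 | ∣n-n∣≡0 θ = *-zeroʳ (w G t)

    defect-H : ∑ ts (defect H) ≡ 0
    defect-H = +-cancelʳ-≡ ((∑[ t ∈ ts ] w H t * value H t) * (2 * θ)) _ 0 (begin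
      ∑ ts (defect H) + (∑[ t ∈ ts ] w H t * value H t) * (2 * θ)
        ≡⟨ defect-sum H ⟩
      (∑[ t ∈ ts ] w H t * (value H t * value H t)) + ∑ ts (w H) * (θ * θ)
        ≡⟨ cong₂ (λ a b → a + b * (θ * θ)) (moment₂ s+1<k) (moment₀ (<⇒≤ (<⇒≤ s+1<k))) ⟨
      (∑[ t ∈ ts ] w G t * (value G t * value G t)) + ∑ ts (w G) * (θ * θ)
        ≡⟨ defect-sum G ⟨
      ∑ ts (defect G) + (∑[ t ∈ ts ] w G t * value G t) * (2 * θ)
        ≡⟨ cong₂ (λ a b → a + b * (2 * θ)) defect-G (moment₁ (<⇒≤ s+1<k)) ⟩
      (∑[ t ∈ ts ] w H t * value H t) * (2 * θ) ∎)

-- Degrees and common neighbours as sums.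

∣tabulate∣ : ∀ n (f : Fin n → Bool) → ∣ Vec.tabulate f ∣ ≡ ∑[ v ∈ allFin n ] ⟦ f v ⟧
∣tabulate∣ zero f = refl
∣tabulate∣ (suc n) f = trans (head-tail (f zero) (Vec.tabulate (f ∘ suc)))
  (trans (cong (⟦ f zero ⟧ +_) (∣tabulate∣ n (f ∘ suc))) (≡.sym (∑-allFin n (⟦_⟧ ∘ f))))
  where
  head-tail : ∀ b (S : Subset n) → ∣ b ∷ S ∣ ≡ ⟦ b ⟧ + ∣ S ∣
  head-tail true S = refl
  head-tail false S = refl

deg : ∀ {n} → Graph n → Fin n → ℕ
deg {n} G u = ∑[ y ∈ allFin n ] ⟦ adj G u y ⟧

com : ∀ {n} → Graph n → Fin n → Fin n → ℕ
com {n} G u v = ∑[ y ∈ allFin n ] ⟦ adj G u y ∧ adj G v y ⟧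

com-self : ∀ {n} (G : Graph n) u → com G u u ≡ deg G u
com-self {n} G u = ∑-cong (allFin n) (λ y → cong ⟦_⟧ (Bool.∧-idem (adj G u y)))

com≤deg : ∀ {n} (G : Graph n) u v → com G u v ≤ deg G u
com≤deg {n} G u v = ∑-mono-≤ (allFin n) (λ y → ⟦∧⟧≤ (adj G u y) (adj G v y))
  where
  ⟦∧⟧≤ : ∀ a b → ⟦ a ∧ b ⟧ ≤ ⟦ a ⟧
  ⟦∧⟧≤ true true = ≤-refl
  ⟦∧⟧≤ true false = z≤n
  ⟦∧⟧≤ false b = z≤n

∑≢0⇒∃ : ∀ {A : Set} (xs : List A) (f : A → Bool) → ∑[ x ∈ xs ] ⟦ f x ⟧ ≢ 0 → ∃ λ x → f x ≡ true
∑≢0⇒∃ [] f ≢0 = ⊥-elim (≢0 refl)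
∑≢0⇒∃ (x ∷ xs) f ≢0 with f x in fx
... | true = x , fx
... | false = ∑≢0⇒∃ xs f ≢0

-- Gives the dichotomy behind the final argument: distinct non-adjacent vertices have either 0 or
-- exactly `μ′` common neighbours.
com≢0⇒Dist2 : ∀ {n} (G : Graph n) {u v} → u ≢ v → adj G u v ≡ false → com G u v ≢ 0 → Dist2 G u v
com≢0⇒Dist2 {n} G {u} {v} u≢v uv com≢0
  with ∑≢0⇒∃ (allFin n) (λ y → adj G u y ∧ adj G v y) com≢0
... | y , e with ∧-true e
... | uy , vy = u≢v , uv , y , uy , trans (sym G y v) vy

record Parameters {n} (G : Graph n) (k l μ′ : ℕ) : Set where
  field
    regular : ∀ u → deg G u ≡ k
    adjacent : ∀ u v → Adj G u v → com G u v ≡ l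
    distance2 : ∀ u v → Dist2 G u v → com G u v ≡ μ′

parameters : ∀ {n} {G : Graph n} {k l μ′} → WeaklyDistanceRegular G k l μ′ → Parameters G k l μ′
parameters {n} {G} (reg , adjc , dist) = record
  { regular = λ u → trans (≡.sym (∣tabulate∣ n _)) (reg u)
  ; adjacent = λ u v uv → trans (≡.sym (∣tabulate∣ n _)) (adjc u v uv)
  ; distance2 = λ u v d → trans (≡.sym (∣tabulate∣ n _)) (dist u v d)
  }

⟦⟧≢0 : ∀ {b} → ⟦ b ⟧ ≢ 0 → b ≡ true
⟦⟧≢0 {true} _ = refl
⟦⟧≢0 {false} ≢0 = ⊥-elim (≢0 refl)

true⇒≢0 : ∀ {b} → b ≡ true → ⟦ b ⟧ ≢ 0
true⇒≢0 refl ()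

-- The open length lets one weight serve both for pairs and for pairs listed with a connecting
-- vertex.
common-weight : ∀ {n s} → Weight n (suc (suc (suc s)))
common-weight G (y ∷ u ∷ v ∷ _) = ⟦ adj G u y ∧ adj G v y ⟧

common-local : ∀ {n s} → Local (common-weight {n} {s})
common-local G H S f inj pres (y ∷ u ∷ v ∷ t) tS with ∧-true {lookup S y} tS
... | yS , tS′ with ∧-true {lookup S u} tS′
... | uS , tS″ with ∧-true {lookup S v} tS″
... | vS , _ = cong₂ (λ a b → ⟦ a ∧ b ⟧) (pres u y uS yS) (pres v y vS yS)

-- Transferring the parameters from `G` to `H`.

-- Each lower bound on `k′` is the length of the index tuple plus the order of the highest moment
-- used: 1 + 2 for degrees, 2 + 2 for adjacent pairs, and 3 + 2, 3 + 1 or 3 + 0 for pairs at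
-- distance 2.
module Transfer {n k′} {G H : Graph n} (k′≤n : k′ ≤ n) (deck : SameDeck k′ G H) where

  regular-transfer : 3 ≤ k′ → ∀ {k} → (∀ u → deg G u ≡ k) → ∀ u → deg H u ≡ k
  regular-transfer 3≤k′ {k} reg u =
    M.constant-transfer 3≤k′ k (λ { (u ∷ []) _ → reg u }) (u ∷ []) λ ()
    where
    g : Weight n 2
    g G (y ∷ u ∷ []) = ⟦ adj G u y ⟧
    g-local : Local g
    g-local G H S f inj pres (y ∷ u ∷ []) tS with ∧-true {lookup S y} tS
    ... | yS , tS′ = cong ⟦_⟧ (pres u y (proj₁ (∧-true {lookup S u} tS′)) yS)
    module M = Moments {G = G} {H} k′≤n deck {1} (λ _ _ → 1) (λ _ _ _ _ _ _ _ _ → refl) g g-local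

  adjacent-transfer : 4 ≤ k′ → ∀ {l} → (∀ u v → Adj G u v → com G u v ≡ l) →
    ∀ u v → Adj H u v → com H u v ≡ l
  adjacent-transfer 4≤k′ {l} adjacent u v uv =
    M.constant-transfer 4≤k′ l (λ { (u ∷ v ∷ []) ≢0 → adjacent u v (⟦⟧≢0 ≢0) }) (u ∷ v ∷ []) (true⇒≢0 uv)
    where
    w : Weight n 2
    w G (u ∷ v ∷ []) = ⟦ adj G u v ⟧
    w-local : Local w
    w-local G H S f inj pres (u ∷ v ∷ []) tS with ∧-true {lookup S u} tS
    ... | uS , tS′ = cong ⟦_⟧ (pres u v uS (proj₁ (∧-true {lookup S v} tS′)))
    module M = Moments {G = G} {H} k′≤n deck w w-local common-weight common-local

  private
    -- Indexing the pairs at distance 2 together with a common neighbour keeps the weight local.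
    path : Graph n → Fin n → Fin n → Fin n → Bool
    path G u v z = not (does (u Fin.≟ v)) ∧ (not (adj G u v) ∧ (adj G u z ∧ adj G v z))

    path-weight : Weight n 3
    path-weight G (u ∷ v ∷ z ∷ []) = ⟦ path G u v z ⟧

    path-local : Local path-weight
    path-local G H S f inj pres (u ∷ v ∷ z ∷ []) tS with ∧-true {lookup S u} tS
    ... | uS , tS′ with ∧-true {lookup S v} tS′
    ... | vS , tS″ with ∧-true {lookup S z} tS″
    ... | zS , _ rewrite pres u v uS vS | pres u z uS zS | pres v z vS zS =
      cong (λ b → ⟦ not b ∧ _ ⟧) same
      where
      same : does (u Fin.≟ v) ≡ does (f u Fin.≟ f v)
      same with u Fin.≟ v | f u Fin.≟ f v
      ... | yes _ | yes _ = refl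
      ... | no _ | no _ = refl
      ... | yes refl | no fu≢fv = ⊥-elim (fu≢fv refl)
      ... | no u≢v | yes fu≡fv = ⊥-elim (u≢v (inj u v uS vS fu≡fv))

    path⇒Dist2 : ∀ {G u v z} → path G u v z ≡ true → Dist2 G u v
    path⇒Dist2 {G} {u} {v} {z} p with u Fin.≟ v | adj G u v in uv
    ... | no u≢v | false with ∧-true p
    ... | uz , vz = u≢v , refl , z , uz , trans (sym G z v) vz

    Dist2⇒path : ∀ {G u v} → Dist2 G u v → ∃ λ z → path G u v z ≡ true
    Dist2⇒path {G} {u} {v} (u≢v , uv , z , uz , zv) = z , p
      where
      p : path G u v z ≡ true
      p rewrite uv | uz | trans (sym G v z) zv with u Fin.≟ v
      ... | yes u≡v = ⊥-elim (u≢v u≡v)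
      ... | no _ = refl

    module M = Moments {G = G} {H} k′≤n deck path-weight path-local common-weight common-local

  distance2-transfer : 5 ≤ k′ → ∀ {μ′} → (∀ u v → Dist2 G u v → com G u v ≡ μ′) →
    ∀ u v → Dist2 H u v → com H u v ≡ μ′
  distance2-transfer 5≤k′ {μ′} dist u v d with Dist2⇒path {H} d
  ... | z , p = M.constant-transfer 5≤k′ μ′
    (λ { (u ∷ v ∷ z ∷ []) ≢0 → dist u v (path⇒Dist2 {G} (⟦⟧≢0 ≢0)) }) (u ∷ v ∷ z ∷ []) (true⇒≢0 p)

  -- The degree `k` bounds every number of common neighbours in `H`, so the first moment already
  -- forces equality. This saves the fifth vertex, which the cards of a six-vertex graph lack.
  distance2-transfer-max : 4 ≤ k′ → ∀ {k} → (∀ u → deg H u ≡ k) →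
    (∀ u v → Dist2 G u v → com G u v ≡ k) → ∀ u v → Dist2 H u v → com H u v ≡ k
  distance2-transfer-max 4≤k′ {k} reg dist u v d with Dist2⇒path {H} d
  ... | z , p = *-cancelˡ-≡ _ _ ⟦ path H u v z ⟧ {{≢-nonZero (true⇒≢0 p)}}
    (M.maximum-transfer 4≤k′ k G-const
      (λ { (u ∷ v ∷ z ∷ []) → *-monoʳ-≤ ⟦ path H u v z ⟧ (≤-trans (com≤deg H u v) (≤-reflexive (reg u))) })
      (u ∷ v ∷ z ∷ []))
    where
    G-const : ∀ t → path-weight G t * M.value G t ≡ path-weight G t * k
    G-const (u ∷ v ∷ z ∷ []) with path G u v z in p
    ... | true = cong (1 *_) (dist u v (path⇒Dist2 {G} p))
    ... | false = refl

  no-distance2-transfer : 3 ≤ k′ → (∀ u v → ¬ Dist2 G u v) → ∀ u v → ¬ Dist2 H u v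
  no-distance2-transfer 3≤k′ none u v d with Dist2⇒path {H} d
  ... | z , p = true⇒≢0 p (M.absent-transfer 3≤k′ absent (u ∷ v ∷ z ∷ []))
    where
    absent : ∀ t → path-weight G t ≡ 0
    absent (u ∷ v ∷ z ∷ []) with path G u v z in p
    ... | true = ⊥-elim (none u v (path⇒Dist2 {G} p))
    ... | false = refl

-- Counting identities and graphs on six vertices.

∑-one : ∀ n → ∑[ _ ∈ allFin n ] 1 ≡ n
∑-one zero = refl
∑-one (suc n) = trans (∑-allFin n (λ _ → 1)) (cong suc (∑-one n))

∑-const : ∀ n c → ∑[ _ ∈ allFin n ] c ≡ c * n
∑-const n c = trans (∑-cong (allFin n) (λ _ → ≡.sym (*-identityʳ c)))
  (trans (≡.sym (*-∑ c (allFin n) (λ _ → 1))) (cong (c *_) (∑-one n)))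

module δ {n} = Enum (finEnum n)

-- Inclusion-exclusion for the two neighbourhoods: neither contains `u` or `v`, which accounts for
-- the 2.
deg+deg≤ : ∀ {n} (G : Graph n) {u v} → u ≢ v → adj G u v ≡ false →
  deg G u + deg G v + 2 ≤ n + com G u v
deg+deg≤ {n} G {u} {v} u≢v uv = begin
  deg G u + deg G v + 2
    ≡⟨ cong (deg G u + deg G v +_) (≡.sym (cong₂ _+_ (δ.once u) (δ.once v))) ⟩
  deg G u + deg G v + (∑ (allFin n) (λ y → δ.δ y u) + ∑ (allFin n) (λ y → δ.δ y v))
    ≡⟨ cong₂ _+_ (≡.sym (∑-+ (allFin n) _ _)) (≡.sym (∑-+ (allFin n) _ _)) ⟩
  (∑[ y ∈ allFin n ] ⟦ adj G u y ⟧ + ⟦ adj G v y ⟧) + (∑[ y ∈ allFin n ] δ.δ y u + δ.δ y v)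
    ≡⟨ ∑-+ (allFin n) _ _ ⟨
  ∑[ y ∈ allFin n ] ⟦ adj G u y ⟧ + ⟦ adj G v y ⟧ + (δ.δ y u + δ.δ y v)
    ≤⟨ ∑-mono-≤ (allFin n) pointwise ⟩
  ∑[ y ∈ allFin n ] 1 + ⟦ adj G u y ∧ adj G v y ⟧
    ≡⟨ ∑-+ (allFin n) _ _ ⟩
  (∑[ y ∈ allFin n ] 1) + com G u v
    ≡⟨ cong (_+ com G u v) (∑-one n) ⟩
  n + com G u v ∎
  where
  open ≤-Reasoning
  pointwise : ∀ y → ⟦ adj G u y ⟧ + ⟦ adj G v y ⟧ + (δ.δ y u + δ.δ y v) ≤ 1 + ⟦ adj G u y ∧ adj G v y ⟧
  pointwise y with y Fin.≟ u | y Fin.≟ v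
  ... | yes refl | yes refl = ⊥-elim (u≢v refl)
  ... | yes refl | no _ rewrite irrefl G u | sym G v u | uv = s≤s z≤n
  ... | no _ | yes refl rewrite irrefl G v | uv = s≤s z≤n
  ... | no _ | no _ with adj G u y | adj G v y
  ... | true | true = ≤-refl
  ... | true | false = ≤-refl
  ... | false | true = ≤-refl
  ... | false | false = z≤n

-- Walks of length 2 from `u`, grouped by end vertex on the left and by middle vertex on the right.
∑-com : ∀ {n} (G : Graph n) {k} → (∀ v → deg G v ≡ k) → ∀ u → ∑[ v ∈ allFin n ] com G u v ≡ k * k
∑-com {n} G {k} reg u = begin
  ∑[ v ∈ allFin n ] ∑[ y ∈ allFin n ] ⟦ adj G u y ∧ adj G v y ⟧
    ≡⟨ ∑-swap (allFin n) (allFin n) _ ⟩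
  ∑[ y ∈ allFin n ] ∑[ v ∈ allFin n ] ⟦ adj G u y ∧ adj G v y ⟧
    ≡⟨ ∑-cong (allFin n) (λ y → trans
         (∑-cong (allFin n) (λ v → trans (⟦∧⟧ (adj G u y) (adj G v y)) (cong (λ b → ⟦ adj G u y ⟧ * ⟦ b ⟧) (sym G v y))))
         (trans (≡.sym (*-∑ ⟦ adj G u y ⟧ (allFin n) _)) (cong (⟦ adj G u y ⟧ *_) (reg y)))) ⟩
  ∑[ y ∈ allFin n ] ⟦ adj G u y ⟧ * k
    ≡⟨ ∑-* (allFin n) _ k ⟨
  deg G u * k
    ≡⟨ cong (_* k) (reg u) ⟩
  k * k ∎
  where open ≡-Reasoning

-- The parameter identity of strongly regular graphs, with no subtraction.
non-adjacent-constant⇒identity : ∀ {n} {G : Graph n} {k l μ′ m} → Parameters G k l μ′ →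
  (∀ {u v} → u ≢ v → adj G u v ≡ false → com G u v ≡ m) → Fin n → k * k + k * m + m ≡ k + k * l + m * n
non-adjacent-constant⇒identity {n} {G} {k} {l} {m = m} par non-adj u = begin
  k * k + k * m + m
    ≡⟨ cong₂ _+_ (cong₂ _+_ (∑-com G regular u) (∑-scaled (regular u)))
         (trans (∑-scaled (δ.once u)) (*-identityˡ m)) ⟨
  ∑ V (com G u) + (∑[ y ∈ V ] ⟦ adj G u y ⟧ * m) + (∑[ y ∈ V ] δ.δ y u * m)
    ≡⟨ ∑-+-+ ⟨
  ∑[ y ∈ V ] com G u y + ⟦ adj G u y ⟧ * m + δ.δ y u * m
    ≡⟨ ∑-cong V pointwise ⟩
  ∑[ y ∈ V ] δ.δ y u * k + ⟦ adj G u y ⟧ * l + m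
    ≡⟨ ∑-+-+ ⟩
  (∑[ y ∈ V ] δ.δ y u * k) + (∑[ y ∈ V ] ⟦ adj G u y ⟧ * l) + (∑[ _ ∈ V ] m)
    ≡⟨ cong₂ _+_ (cong₂ _+_ (trans (∑-scaled (δ.once u)) (*-identityˡ k)) (∑-scaled (regular u))) (∑-const n m) ⟩
  k + k * l + m * n ∎
  where
  open Parameters par
  open ≡-Reasoning
  V = allFin n

  ∑-scaled : ∀ {f : Fin n → ℕ} {a c} → ∑ V f ≡ a → ∑[ y ∈ V ] f y * c ≡ a * c
  ∑-scaled {f} {c = c} e = trans (≡.sym (∑-* V f c)) (cong (_* c) e)

  ∑-+-+ : ∀ {f g h : Fin n → ℕ} → ∑[ y ∈ V ] f y + g y + h y ≡ ∑ V f + ∑ V g + ∑ V h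
  ∑-+-+ {f} {g} {h} = trans (∑-+ V _ h) (cong (_+ ∑ V h) (∑-+ V f g))

  -- `com G u y` is `k`, `l` or `m` according to whether `y` is `u`, a neighbour of `u` or neither;
  -- in the first two cases the constant `m` on the right is balanced on the left.
  pointwise : ∀ y → com G u y + ⟦ adj G u y ⟧ * m + δ.δ y u * m ≡ δ.δ y u * k + ⟦ adj G u y ⟧ * l + m
  pointwise y with y Fin.≟ u | adj G u y in uy
  ... | yes refl | true with () ← trans (≡.sym (irrefl G u)) uy
  ... | yes refl | false = trans (cong (λ d → d + 0 * m + 1 * m) (trans (com-self G u) (regular u))) (tidy k m)
    where
    tidy : ∀ k m → k + 0 * m + 1 * m ≡ 1 * k + 0 * m + m
    tidy = solve-∀
  ... | no y≢u | true = trans (cong (λ d → d + 1 * m + 0 * m) (adjacent u y uy)) (tidy l m)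
    where
    tidy : ∀ l m → l + 1 * m + 0 * m ≡ 0 * m + 1 * l + m
    tidy = solve-∀
  ... | no y≢u | false = trans (+-identityʳ _) (trans (+-identityʳ _) (non-adj (λ u≡y → y≢u (≡.sym u≡y)) uy))

-- Inclusion-exclusion leaves only k = 3 and μ′ = 2; then all non-adjacent pairs have two common
-- neighbours, and counting the walks of length 2 from u gives 9 = 3 + 3 l + 2 * 2.
six-vertices : ∀ {G : Graph 6} {k l μ′} → Parameters G k l μ′ → 2 ≤ μ′ →
  ∀ u v → Dist2 G u v → μ′ ≡ k
six-vertices {G} {k} {l} {μ′} par 2≤μ′ u v d@(u≢v , uv , _)
  with m≤n⇒m<n∨m≡n (subst₂ _≤_ (Parameters.distance2 par u v d) (Parameters.regular par u) (com≤deg G u v))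
... | inj₂ μ′≡k = μ′≡k
... | inj₁ μ′<k = ⊥-elim (impossible k≡3 μ′≡2)
  where
  open Parameters par
  incl-excl : ∀ {u v} → u ≢ v → adj G u v ≡ false → k + k + 2 ≤ 6 + com G u v
  incl-excl {u} {v} u≢v uv =
    subst₂ (λ a b → a + b + 2 ≤ 6 + com G u v) (regular u) (regular v) (deg+deg≤ G u≢v uv)

  -- Combines `2k + 2 ≤ 6 + μ′` with `μ′ + 1 ≤ k`.
  k≤3 : k ≤ 3
  k≤3 = +-cancelˡ-≤ (2 + k) k 3 (begin
    2 + k + k       ≡⟨ trans (+-assoc 2 k k) (+-comm 2 (k + k)) ⟩
    k + k + 2       ≤⟨ incl-excl u≢v uv ⟩
    6 + com G u v   ≡⟨ cong (6 +_) (distance2 u v d) ⟩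
    5 + suc μ′      ≤⟨ +-monoʳ-≤ 5 μ′<k ⟩
    5 + k           ≡⟨ +-comm 5 k ⟩
    k + 5           ≡⟨ +-assoc k 2 3 ⟨
    k + 2 + 3       ≡⟨ cong (_+ 3) (+-comm k 2) ⟩
    2 + k + 3       ∎)
    where open ≤-Reasoning

  k≡3 : k ≡ 3
  k≡3 = ≤-antisym k≤3 (≤-trans (s≤s 2≤μ′) μ′<k)

  μ′≡2 : μ′ ≡ 2
  μ′≡2 = ≤-antisym (≤-pred (≤-trans μ′<k k≤3)) 2≤μ′

  impossible : k ≡ 3 → μ′ ≢ 2
  -- The identity reads `9 + 6 + 2 ≡ 3 + 3 l + 12`, which would make 2 a multiple of 3.
  impossible refl refl = mod-3 l (+-cancelˡ-≡ 15 2 (l * 3) (begin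
    17              ≡⟨ non-adjacent-constant⇒identity par non-adj u ⟩
    3 + 3 * l + 12  ≡⟨ trans (+-comm (3 + 3 * l) 12) (cong (15 +_) (*-comm 3 l)) ⟩
    15 + l * 3      ∎))
    where
    open ≡-Reasoning
    mod-3 : ∀ l → 2 ≢ l * 3
    mod-3 zero ()
    mod-3 (suc l) ()

    8≰6 : ¬ (8 ≤ 6)
    8≰6 (s≤s (s≤s (s≤s (s≤s (s≤s (s≤s ()))))))

    -- Without a common neighbour, inclusion-exclusion at `k ≡ 3` would give `8 ≤ 6`; so every
    -- non-adjacent pair is at distance 2.
    non-adj : ∀ {u v} → u ≢ v → adj G u v ≡ false → com G u v ≡ 2
    non-adj {u} {v} u≢v uv = distance2 u v
      (com≢0⇒Dist2 G u≢v uv (λ e → 8≰6 (subst (λ c → 8 ≤ 6 + c) e (incl-excl u≢v uv))))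

parameters-transfer : ∀ {n} → 6 ≤ n → {G H : Graph n} → SameDeck (n ∸ 2) G H →
  ∀ {k l μ′} → Parameters G k l μ′ → 2 ≤ μ′ → Parameters H k l μ′
parameters-transfer {n} 6≤n {G} {H} deck {k} {l} {μ′} par 2≤μ′ = record
  { regular = regular-H
  ; adjacent = adjacent-transfer 4≤n-2 adjacent
  ; distance2 = distance2-H
  }
  where
  open Parameters par
  open Transfer {G = G} {H} (m∸n≤m n 2) deck

  4≤n-2 : 4 ≤ n ∸ 2
  4≤n-2 = ∸-monoˡ-≤ 2 6≤n

  regular-H : ∀ u → deg H u ≡ k
  regular-H = regular-transfer (<⇒≤ 4≤n-2) regular

  distance2-H : ∀ u v → Dist2 H u v → com H u v ≡ μ′
  distance2-H with m≤n⇒m<n∨m≡n 6≤n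
  ... | inj₁ 7≤n = distance2-transfer (∸-monoˡ-≤ 2 7≤n) distance2
  -- Cards now have four vertices, one too few for the second moment. Either `μ′` equals the upper
  -- bound `k`, or by `six-vertices` there is no pair at distance 2 in `G`, which three-vertex
  -- patterns detect.
  ... | inj₂ refl with μ′ ℕ.≟ k
  ... | yes refl = distance2-transfer-max ≤-refl regular-H distance2
  ... | no μ′≢k = λ u v d → ⊥-elim (no-distance2-transfer (n≤1+n 3)
    (λ u v d → μ′≢k (six-vertices par 2≤μ′ u v d)) u v d)

-- Cards with two vertices missing.

-- Presents `S` as the complement of an ordered pair; the order matters because the isomorphism may
-- have to exchange the two vertices.
record CoPair {n} (S : Subset n) (u v : Fin n) : Set where
  field
    distinct : u ≢ v
    u∉ : lookup S u ≡ false
    v∉ : lookup S v ≡ false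
    rest : ∀ z → z ≢ u → z ≢ v → lookup S z ≡ true

  ∉⇒≢ : ∀ {w z} → lookup S w ≡ false → lookup S z ≡ true → z ≢ w
  ∉⇒≢ wS zS refl with () ← trans (≡.sym wS) zS

  ∑-coPair : ∀ (h : Fin n → ℕ) → ∑ (allFin n) h ≡ h u + h v + (∑[ z ∈ allFin n ] ⟦ lookup S z ⟧ * h z)
  ∑-coPair h = begin
    ∑ (allFin n) h
      ≡⟨ ∑-cong (allFin n) pointwise ⟩
    ∑[ z ∈ allFin n ] δ.δ z u * h z + δ.δ z v * h z + ⟦ lookup S z ⟧ * h z
      ≡⟨ trans (∑-+ (allFin n) _ _) (cong (_+ (∑[ z ∈ allFin n ] ⟦ lookup S z ⟧ * h z)) (∑-+ (allFin n) _ _)) ⟩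
    (∑[ z ∈ allFin n ] δ.δ z u * h z) + (∑[ z ∈ allFin n ] δ.δ z v * h z) + (∑[ z ∈ allFin n ] ⟦ lookup S z ⟧ * h z)
      ≡⟨ cong₂ (λ a b → a + b + (∑[ z ∈ allFin n ] ⟦ lookup S z ⟧ * h z)) (δ.sift u h) (δ.sift v h) ⟩
    h u + h v + (∑[ z ∈ allFin n ] ⟦ lookup S z ⟧ * h z) ∎
    where
    open ≡-Reasoning
    pointwise : ∀ z → h z ≡ δ.δ z u * h z + δ.δ z v * h z + ⟦ lookup S z ⟧ * h z
    pointwise z with z Fin.≟ u | z Fin.≟ v
    ... | yes refl | yes refl = ⊥-elim (distinct refl)
    ... | yes refl | no _ rewrite u∉ = units (h z)
      where
      units : ∀ a → a ≡ 1 * a + 0 * a + 0 * a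
      units = solve-∀
    ... | no _ | yes refl rewrite v∉ = units (h z)
      where
      units : ∀ a → a ≡ 0 * a + 1 * a + 0 * a
      units = solve-∀
    ... | no z≢u | no z≢v rewrite rest z z≢u z≢v = ≡.sym (*-identityˡ (h z))

coPair-swap : ∀ {n} {S : Subset n} {u v} → CoPair S u v → CoPair S v u
coPair-swap P = record
  { distinct = λ e → distinct (≡.sym e) ; u∉ = v∉ ; v∉ = u∉ ; rest = λ z z≢v z≢u → rest z z≢u z≢v }
  where open CoPair P

full : ∀ {n} (S : Subset n) → ∣ S ∣ ≡ n → ∀ z → lookup S z ≡ true
full S e z rewrite ∣p∣≡n⇒p≡⊤ {p = S} e = Vec.lookup-replicate z inside

missing-one : ∀ {n} (S : Subset n) → suc ∣ S ∣ ≡ n →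
  ∃ λ u → lookup S u ≡ false × (∀ z → z ≢ u → lookup S z ≡ true)
missing-one (true ∷ S) e with missing-one S (suc-injective e)
... | u , u∉ , rest = suc u , u∉ , λ { zero _ → refl ; (suc z) z≢u → rest z (z≢u ∘ cong suc) }
missing-one (false ∷ S) e =
  zero , refl , λ { zero z≢0 → ⊥-elim (z≢0 refl) ; (suc z) _ → full S (suc-injective e) z }

missing-two : ∀ {n} (S : Subset n) → suc (suc ∣ S ∣) ≡ n → ∃₂ (CoPair S)
missing-two (true ∷ S) e with missing-two S (suc-injective e)
... | u , v , P = suc u , suc v , record
  { distinct = distinct ∘ Fin.suc-injective ; u∉ = u∉ ; v∉ = v∉
  ; rest = λ { zero _ _ → refl ; (suc z) z≢u z≢v → rest z (z≢u ∘ cong suc) (z≢v ∘ cong suc) } }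
  where open CoPair P
missing-two (false ∷ S) e with missing-one S (suc-injective e)
... | u , u∉ , rest = zero , suc u , record
  { distinct = λ () ; u∉ = refl ; v∉ = u∉
  ; rest = λ { zero z≢0 _ → ⊥-elim (z≢0 refl) ; (suc z) _ z≢u → rest z (z≢u ∘ cong suc) } }

-- Extending a card isomorphism to the whole graph.

extend : ∀ {n} (u v x y : Fin n) → (Fin n → Fin n) → Fin n → Fin n
extend u v x y f z with z Fin.≟ u | z Fin.≟ v
... | yes _ | _ = x
... | no _ | yes _ = y
... | no _ | no _ = f z

-- Matching on a position refines `z` itself, after which `extend` is evaluated by its three
-- rewriting lemmas.
data Position {n} (S : Subset n) (u v : Fin n) : Fin n → Set where
  at-u : Position S u v u
  at-v : Position S u v v
  in-S : ∀ {z} → lookup S z ≡ true → Position S u v z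

module Extend {n} {S : Subset n} {u v} (P : CoPair S u v) (x y : Fin n) (f : Fin n → Fin n) where
  open CoPair P

  position : ∀ z → Position S u v z
  position z with z Fin.≟ u | z Fin.≟ v
  ... | yes refl | _ = at-u
  ... | no _ | yes refl = at-v
  ... | no z≢u | no z≢v = in-S (rest z z≢u z≢v)

  extend-u : extend u v x y f u ≡ x
  extend-u with u Fin.≟ u | u Fin.≟ v
  ... | yes _ | _ = refl
  ... | no u≢u | _ = ⊥-elim (u≢u refl)

  extend-v : extend u v x y f v ≡ y
  extend-v with v Fin.≟ u | v Fin.≟ v
  ... | yes v≡u | _ = ⊥-elim (distinct (≡.sym v≡u))
  ... | no _ | yes _ = refl
  ... | no _ | no v≢v = ⊥-elim (v≢v refl)

  extend-S : ∀ {z} → lookup S z ≡ true → extend u v x y f z ≡ f z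
  extend-S {z} zS with z Fin.≟ u | z Fin.≟ v
  ... | yes z≡u | _ = ⊥-elim (∉⇒≢ u∉ zS z≡u)
  ... | no _ | yes z≡v = ⊥-elim (∉⇒≢ v∉ zS z≡v)
  ... | no _ | no _ = refl

extend-inverse : ∀ {n} {S T : Subset n} {u v x y} → CoPair S u v → CoPair T x y → (f g : Fin n → Fin n) →
  (∀ z → lookup S z ≡ true → lookup T (f z) ≡ true) → (∀ z → lookup S z ≡ true → g (f z) ≡ z) →
  ∀ z → extend x y u v g (extend u v x y f z) ≡ z
extend-inverse {u = u} {v} {x} {y} P Q f g f-∈ gf z with Extend.position P x y f z
... | at-u = trans (cong (extend x y u v g) (Extend.extend-u P x y f)) (Extend.extend-u Q u v g)
... | at-v = trans (cong (extend x y u v g) (Extend.extend-v P x y f)) (Extend.extend-v Q u v g)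
... | in-S zS = trans (cong (extend x y u v g) (Extend.extend-S P x y f zS))
  (trans (Extend.extend-S Q u v g (f-∈ z zS)) (gf z zS))

∑-cardIso : ∀ {n} {G H : Graph n} {S T} (φ : CardIso G S H T) (h h′ : Fin n → ℕ) →
  (∀ z → lookup S z ≡ true → h z ≡ h′ (CardIso.to φ z)) →
  ∑[ z ∈ allFin n ] ⟦ lookup S z ⟧ * h z ≡ ∑[ z ∈ allFin n ] ⟦ lookup T z ⟧ * h′ z
∑-cardIso {n} {S = S} {T} φ h h′ hh′ =
  ∑-reindex (finEnum n) (finEnum n) (lookup S) (lookup T) to from to-∈ from-∈ from-to to-from h h′ hh′
  where open CardIso φ

⟦⟧-injective : ∀ {a b} → ⟦ a ⟧ ≡ ⟦ b ⟧ → a ≡ b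
⟦⟧-injective {true} {true} _ = refl
⟦⟧-injective {false} {false} _ = refl

deg-coPair : ∀ {n} (G : Graph n) {S u v} → CoPair S u v →
  deg G u ≡ ⟦ adj G u v ⟧ + (∑[ z ∈ allFin n ] ⟦ lookup S z ⟧ * ⟦ adj G z u ⟧)
deg-coPair {n} G {S} {u} {v} P = trans (CoPair.∑-coPair P _)
  (cong₂ (λ a b → ⟦ a ⟧ + ⟦ adj G u v ⟧ + b) (irrefl G u)
    (∑-cong (allFin n) (λ z → cong (λ b → ⟦ lookup S z ⟧ * ⟦ b ⟧) (sym G u z))))

-- Only the adjacency of `u` and `v` is left open by the hypotheses on the card. Regularity settles
-- it: `u` and `x` have equal degrees and equally many neighbours inside their cards.
extend-cardIso : ∀ {n} {G H : Graph n} {k} → (∀ z → deg G z ≡ k) → (∀ z → deg H z ≡ k) →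
  ∀ {S T u v x y} → CoPair S u v → CoPair T x y → (φ : CardIso G S H T) →
  (∀ z → lookup S z ≡ true → adj G z u ≡ adj H (CardIso.to φ z) x) →
  (∀ z → lookup S z ≡ true → adj G z v ≡ adj H (CardIso.to φ z) y) → G ≅ H
extend-cardIso {n} {G} {H} reg-G reg-H {S} {T} {u} {v} {x} {y} P Q φ to-x to-y =
  F , extend x y u v from ,
  extend-inverse P Q to from to-∈ from-to , extend-inverse Q P from to from-∈ to-from , F-adj
  where
  open CardIso φ
  open Extend P x y to
  F = extend u v x y to

  uv-xy : adj G u v ≡ adj H x y
  uv-xy = ⟦⟧-injective (+-cancelʳ-≡ _ _ _ (begin
    ⟦ adj G u v ⟧ + (∑[ z ∈ allFin n ] ⟦ lookup S z ⟧ * ⟦ adj G z u ⟧)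
      ≡⟨ deg-coPair G P ⟨
    deg G u
      ≡⟨ trans (reg-G u) (≡.sym (reg-H x)) ⟩
    deg H x
      ≡⟨ deg-coPair H Q ⟩
    ⟦ adj H x y ⟧ + (∑[ z ∈ allFin n ] ⟦ lookup T z ⟧ * ⟦ adj H z x ⟧)
      ≡⟨ cong (⟦ adj H x y ⟧ +_) (∑-cardIso φ (λ z → ⟦ adj G z u ⟧) (λ z → ⟦ adj H z x ⟧) (λ z zS → cong ⟦_⟧ (to-x z zS))) ⟨
    ⟦ adj H x y ⟧ + (∑[ z ∈ allFin n ] ⟦ lookup S z ⟧ * ⟦ adj G z u ⟧) ∎))
    where open ≡-Reasoning

  F-adj-S : ∀ {w z} → lookup S w ≡ true → Position S u v z → adj G w z ≡ adj H (to w) (F z)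
  F-adj-S {w} wS at-u rewrite extend-u = to-x w wS
  F-adj-S {w} wS at-v rewrite extend-v = to-y w wS
  F-adj-S {w} {z} wS (in-S zS) rewrite extend-S zS = to-adj w z wS zS

  F-adj : ∀ w z → adj G w z ≡ adj H (F w) (F z)
  F-adj w z with position w | position z
  ... | in-S wS | pz = trans (F-adj-S wS pz) (cong (λ a → adj H a (F z)) (≡.sym (extend-S wS)))
  ... | pw | in-S zS = trans (sym G w z) (trans (F-adj-S zS pw)
    (trans (sym H (to z) (F w)) (cong (adj H (F w)) (≡.sym (extend-S zS)))))
  ... | at-u | at-u rewrite extend-u = trans (irrefl G u) (≡.sym (irrefl H x))
  ... | at-u | at-v rewrite extend-u | extend-v = uv-xy
  ... | at-v | at-u rewrite extend-u | extend-v = trans (sym G v u) (trans uv-xy (sym H x y))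
  ... | at-v | at-v rewrite extend-v = trans (irrefl G v) (≡.sym (irrefl H y))

-- Adjacency vectors towards the two removed vertices.

-- A pair records adjacency to the first and to the second removed vertex. `dot` then counts the
-- removed common neighbours of two card vertices, and `weight` the removed neighbours of one.
dot : Bool × Bool → Bool × Bool → ℕ
dot (a , b) (c , d) = ⟦ a ∧ c ⟧ + ⟦ b ∧ d ⟧

weight : Bool × Bool → ℕ
weight (a , b) = ⟦ a ⟧ + ⟦ b ⟧

2≤dot : ∀ p q → 2 ≤ dot p q → weight p ≡ 2 × weight q ≡ 2
2≤dot (true , true) (true , true) _ = refl , refl
2≤dot (true , true) (true , false) (s≤s ())
2≤dot (true , true) (false , true) (s≤s ())
2≤dot (true , false) (true , _) (s≤s ())
2≤dot (false , true) (_ , true) (s≤s ())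

weight-2 : ∀ p q → weight p ≡ 2 → weight q ≡ 2 → dot p q ≡ 2
weight-2 (true , true) (true , true) _ _ = refl
weight-2 (true , false) _ ()
weight-2 (false , true) _ ()
weight-2 (true , true) (true , false) _ ()
weight-2 (true , true) (false , true) _ ()

-- An overlap of 2 forces all four entries of `p′` and `q′` to be true; weight 2 then does the same
-- for `p` and `q`, whose overlap cannot be 0.
no-overlap-gain : ∀ {p q p′ q′} → weight p ≡ weight p′ → weight q ≡ weight q′ →
  dot p q ≡ 0 → ¬ (2 ≤ dot p′ q′)
no-overlap-gain {p} {q} {p′} {q′} wp wq pq≡0 2≤p′q′ with 2≤dot p′ q′ 2≤p′q′
... | wp′ , wq′ with () ← trans (≡.sym (weight-2 p q (trans wp wp′) (trans wq wq′))) pq≡0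

same-second : ∀ {a b b′} → weight (a , b) ≡ weight (a , b′) → b ≡ b′
same-second {a} e = ⟦⟧-injective (+-cancelˡ-≡ ⟦ a ⟧ _ _ e)

-- With its weight kept, `p` can change its first entry only by exchanging a single true with a
-- false. So `dot` with `p` reads off one entry of `q`, `dot` with `p′` reads off the opposite entry
-- of `q′`, and equal weights give the remaining entries. One crossed vertex thus forces all others
-- to cross.
crossed : ∀ {p q p′ q′} → weight p ≡ weight p′ → weight q ≡ weight q′ → dot p q ≡ dot p′ q′ →
  proj₁ p ≢ proj₁ p′ → proj₁ q ≡ proj₂ q′ × proj₂ q ≡ proj₁ q′
crossed {true , b} {p′ = true , b′} _ _ _ ≢ = ⊥-elim (≢ refl)
crossed {false , b} {p′ = false , b′} _ _ _ ≢ = ⊥-elim (≢ refl)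
crossed {true , false} {c , d} {false , true} {c′ , d′} _ wq pq _
  with refl ← ⟦⟧-injective {c} {d′} (trans (≡.sym (+-identityʳ ⟦ c ⟧)) pq) =
  refl , same-second {c} (trans wq (+-comm ⟦ c′ ⟧ ⟦ c ⟧))
crossed {false , true} {c , d} {true , false} {c′ , d′} _ wq pq _
  with refl ← ⟦⟧-injective {d} {c′} (trans pq (+-identityʳ ⟦ c′ ⟧)) =
  same-second {d} (trans (+-comm ⟦ d ⟧ ⟦ c ⟧) wq) , refl

-- Matching the removed vertices.

module Card {n} {G H : Graph n} {k l μ′} (par-G : Parameters G k l μ′) (par-H : Parameters H k l μ′)
  (2≤μ′ : 2 ≤ μ′) {S T : Subset n} {u v x y : Fin n} (P : CoPair S u v) (Q : CoPair T x y)
  (φ : CardIso G S H T) where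
  open CardIso φ

  old : Fin n → Bool × Bool
  old z = adj G z u , adj G z v

  new : Fin n → Bool × Bool
  new z = adj H (to z) x , adj H (to z) y

  -- The degrees agree by regularity, and the neighbours inside the card agree by the isomorphism;
  -- the difference is the weight.
  weight-agrees : ∀ w → lookup S w ≡ true → weight (old w) ≡ weight (new w)
  weight-agrees w wS = +-cancelʳ-≡ _ _ _ (begin
    weight (old w) + (∑[ z ∈ allFin n ] ⟦ lookup S z ⟧ * ⟦ adj G w z ⟧)
      ≡⟨ CoPair.∑-coPair P _ ⟨
    deg G w
      ≡⟨ trans (Parameters.regular par-G w) (≡.sym (Parameters.regular par-H (to w))) ⟩
    deg H (to w)
      ≡⟨ CoPair.∑-coPair Q _ ⟩
    weight (new w) + (∑[ z ∈ allFin n ] ⟦ lookup T z ⟧ * ⟦ adj H (to w) z ⟧)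
      ≡⟨ cong (weight (new w) +_) (∑-cardIso φ (λ z → ⟦ adj G w z ⟧) (λ z → ⟦ adj H (to w) z ⟧)
           (λ z zS → cong ⟦_⟧ (to-adj w z wS zS))) ⟨
    weight (new w) + (∑[ z ∈ allFin n ] ⟦ lookup S z ⟧ * ⟦ adj G w z ⟧) ∎)
    where open ≡-Reasoning

  inner : Fin n → Fin n → ℕ
  inner w z = ∑[ y ∈ allFin n ] ⟦ lookup S y ⟧ * ⟦ adj G w y ∧ adj G z y ⟧

  com-old : ∀ w z → com G w z ≡ dot (old w) (old z) + inner w z
  com-old w z = CoPair.∑-coPair P _

  com-new : ∀ {w z} → lookup S w ≡ true → lookup S z ≡ true →
    com H (to w) (to z) ≡ dot (new w) (new z) + inner w z
  com-new {w} {z} wS zS = trans (CoPair.∑-coPair Q _) (cong (dot (new w) (new z) +_)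
    (≡.sym (∑-cardIso φ _ _ (λ y yS → cong₂ (λ a b → ⟦ a ∧ b ⟧) (to-adj w y wS yS) (to-adj z y zS yS)))))

  com-agrees⇒dot-agrees : ∀ {w z} → lookup S w ≡ true → lookup S z ≡ true →
    com G w z ≡ com H (to w) (to z) → dot (old w) (old z) ≡ dot (new w) (new z)
  com-agrees⇒dot-agrees {w} {z} wS zS e = +-cancelʳ-≡ (inner w z) _ _
    (trans (≡.sym (com-old w z)) (trans e (com-new wS zS)))

  -- Since `inner` is preserved, it suffices that `com` agrees. It is `k` for equal vertices, `l`
  -- for adjacent ones, and otherwise 0 or `μ′`; only a change between these last two values has to
  -- be excluded.
  dot-agrees : ∀ w z → lookup S w ≡ true → lookup S z ≡ true → dot (old w) (old z) ≡ dot (new w) (new z)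
  dot-agrees w z wS zS with w Fin.≟ z | adj G w z in wz
  ... | yes refl | _ = com-agrees⇒dot-agrees wS wS
    (trans (trans (com-self G w) (Parameters.regular par-G w))
      (≡.sym (trans (com-self H (to w)) (Parameters.regular par-H (to w)))))
  ... | no _ | true = com-agrees⇒dot-agrees wS zS
    (trans (Parameters.adjacent par-G w z wz)
      (≡.sym (Parameters.adjacent par-H (to w) (to z) (trans (≡.sym (to-adj w z wS zS)) wz))))
  ... | no w≢z | false = non-adjacent (com G w z ℕ.≟ 0) (com H (to w) (to z) ℕ.≟ 0)
    where
    μ-G : com G w z ≢ 0 → com G w z ≡ μ′
    μ-G ≢0 = Parameters.distance2 par-G w z (com≢0⇒Dist2 G w≢z wz ≢0)

    μ-H : com H (to w) (to z) ≢ 0 → com H (to w) (to z) ≡ μ′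
    μ-H ≢0 = Parameters.distance2 par-H (to w) (to z) (com≢0⇒Dist2 H (w≢z ∘ to-injective w z wS zS)
      (trans (≡.sym (to-adj w z wS zS)) wz) ≢0)

    non-adjacent : Dec (com G w z ≡ 0) → Dec (com H (to w) (to z) ≡ 0) →
      dot (old w) (old z) ≡ dot (new w) (new z)
    non-adjacent (yes c≡0) (yes c′≡0) = com-agrees⇒dot-agrees wS zS (trans c≡0 (≡.sym c′≡0))
    non-adjacent (no c≢0) (no c′≢0) = com-agrees⇒dot-agrees wS zS (trans (μ-G c≢0) (≡.sym (μ-H c′≢0)))
    -- No common neighbour in `G` means none inside the card, so in `H` all `μ′ ≥ 2` of them are
    -- removed vertices, against `no-overlap-gain`. The next clause exchanges the roles.
    non-adjacent (yes c≡0) (no c′≢0) = ⊥-elim (no-overlap-gain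
      {old w} {old z} {new w} {new z} (weight-agrees w wS) (weight-agrees z zS)
      (m+n≡0⇒m≡0 _ old+inner≡0) (subst (2 ≤_) μ′≡dot 2≤μ′))
      where
      old+inner≡0 : dot (old w) (old z) + inner w z ≡ 0
      old+inner≡0 = trans (≡.sym (com-old w z)) c≡0
      μ′≡dot : μ′ ≡ dot (new w) (new z)
      μ′≡dot = trans (≡.sym (μ-H c′≢0)) (trans (com-new wS zS)
        (trans (cong (dot (new w) (new z) +_) (m+n≡0⇒n≡0 (dot (old w) (old z)) old+inner≡0)) (+-identityʳ _)))
    non-adjacent (no c≢0) (yes c′≡0) = ⊥-elim (no-overlap-gain
      {new w} {new z} {old w} {old z} (≡.sym (weight-agrees w wS)) (≡.sym (weight-agrees z zS))
      (m+n≡0⇒m≡0 _ new+inner≡0) (subst (2 ≤_) μ′≡dot 2≤μ′))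
      where
      new+inner≡0 : dot (new w) (new z) + inner w z ≡ 0
      new+inner≡0 = trans (≡.sym (com-new wS zS)) c′≡0
      μ′≡dot : μ′ ≡ dot (old w) (old z)
      μ′≡dot = trans (≡.sym (μ-G c≢0)) (trans (com-old w z)
        (trans (cong (dot (old w) (old z) +_) (m+n≡0⇒n≡0 (dot (new w) (new z)) new+inner≡0)) (+-identityʳ _)))

  isomorphic : G ≅ H
  -- A card vertex whose adjacency to `u` differs from that of its image to `x` decides the
  -- matching: then `u` goes to `y` and `v` to `x`, otherwise `u` goes to `x` and `v` to `y`.
  isomorphic with Fin.any? (λ w → (lookup S w Bool.≟ true) ×-dec ¬? (proj₁ (old w) Bool.≟ proj₁ (new w)))
  ... | yes (w , wS , w-moved) =
    extend-cardIso (Parameters.regular par-G) (Parameters.regular par-H) P (coPair-swap Q) φ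
      (λ z zS → proj₁ (swapped z zS)) (λ z zS → proj₂ (swapped z zS))
    where
    swapped : ∀ z → lookup S z ≡ true → proj₁ (old z) ≡ proj₂ (new z) × proj₂ (old z) ≡ proj₁ (new z)
    swapped z zS = crossed {old w} {old z} {new w} {new z}
      (weight-agrees w wS) (weight-agrees z zS) (dot-agrees w z wS zS) w-moved
  ... | no none-moved =
    extend-cardIso (Parameters.regular par-G) (Parameters.regular par-H) P Q φ first second
    where
    first : ∀ z → lookup S z ≡ true → adj G z u ≡ adj H (to z) x
    first z zS with adj G z u Bool.≟ adj H (to z) x
    ... | yes e = e
    ... | no ≢ = ⊥-elim (none-moved (z , zS , ≢))
    second : ∀ z → lookup S z ≡ true → adj G z v ≡ adj H (to z) y
    second z zS = same-second {adj G z u} (trans (weight-agrees z zS)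
      (cong (λ a → weight (a , adj H (to z) y)) (≡.sym (first z zS))))

-- Reconstruction from a single card.

-- The whole deck serves to transfer the parameters; after that any one card and its partner
-- suffice.
some-pair-removed : ∀ n → 2 ≤ n → ∃ λ (S : Subset n) → ∣ S ∣ ≡ n ∸ 2
some-pair-removed (suc (suc n)) _ = false ∷ false ∷ ⊤ , ∣⊤∣≡n n
some-pair-removed (suc zero) (s≤s ())

theorem3 : (n : ℕ) → 6 ≤ n → (G : Graph n) → (k l μ′ : ℕ) →
    WeaklyDistanceRegular G k l μ′ → 2 ≤ μ′ → Reconstructible 2 G
theorem3 n 6≤n G k l μ′ wdr 2≤μ′ H deck@(φ , _ , φ-size , _ , _ , _ , iso)
  with some-pair-removed n (≤-trans (s≤s (s≤s z≤n)) 6≤n)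
... | S , ∣S∣ with missing-two S (two-more ∣S∣) | missing-two (φ S) (two-more (φ-size S ∣S∣))
  where
  two-more : ∀ {m} → m ≡ n ∸ 2 → suc (suc m) ≡ n
  two-more e = trans (cong (2 +_) e) (m+[n∸m]≡n (≤-trans (s≤s (s≤s z≤n)) 6≤n))
... | _ , _ , P | _ , _ , Q =
  Card.isomorphic {G = G} {H} par (parameters-transfer 6≤n deck par 2≤μ′) 2≤μ′ P Q (cardIso (iso S ∣S∣))
  where
  par : Parameters G k l μ′
  par = parameters wdr
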